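{- Let $(W,S)$ be a finite Coxeter system, $Q=q_1\cdots q_m$ a word on $S$, and $\rho\in W$ such that the subword complex $\mathcal{SC}(Q,\rho)$ is double root free. Let $I$ and $J$ be two facets of $\mathcal{SC}(Q,\rho)$ such that there is a directed path from $I$ to $J$ in the increasing flip graph $\mathcal G(Q,\rho)$. Then the unique $\mathsf p$-rising (resp. $\mathsf n$-rising) path from $I$ to $J$ has maximal length among all paths from $I$ to $J$. Moreover, if there is a $\mathsf p$-falling (resp. $\mathsf n$-falling) path from $I$ to $J$, it has minimal length among all paths from $I$ to $J$.
   Context: Let $(W,S)$ be a finite Coxeter system acting by reflections on a Euclidean space $V$, with length function $\ell$, root system $\Phi$ and simple roots $\{\alpha_s: s\in S\}$. Let $Q=q_1q_2\cdots q_m$ be a word in the letters $S$ and $\rho\in W$; write $[m]=\{1,\dots,m\}$. The subword complex $\mathcal{SC}(Q,\rho)$ is the simplicial complex whose facets are the sets $I\subseteq[m]$ such that the letters of $Q$ at the positions in $[m]\setminus I$, read in increasing order of position, form a reduced expression of $\rho$. The root function of a facet $I$ is $\mathsf r(I,k)=w(\alpha_{q_k})\in\Phi$ for $k\in[m]$, where $w$ is the product of the $q_x$, $x\in[k-1]\setminus I$, in increasing order of position. Two distinct facets $I,J$ are adjacent if $I\setminus\{i\}=J\setminus\{j\}$ for some $i\in I$, $j\in J$; then $i$ is called flippable in $I$. The flip from $I$ to $J$ is increasing if $i<j$. The increasing flip graph $\mathcal G(Q,\rho)$ is the directed graph whose vertices are the facets and whose edges $I\to J$ are the increasing flips. For an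 edge $I\to J$ with $I\setminus\{i\}=J\setminus\{j\}$, $i<j$, set $\mathsf p(I\to J)=i$ and $\mathsf n(I\to J)=j$. For $\lambda\in\{\mathsf p,\mathsf n\}$, a path is $\lambda$-rising (resp. $\lambda$-falling) if the sequence of $\lambda$-labels of its successive edges is strictly increasing (resp. weakly decreasing); its length is its number of edges. Whenever there is a directed path from $I$ to $J$, there is exactly one $\lambda$-rising path from $I$ to $J$. The subword complex has a double root if there is a facet $I$ and two distinct positions $i\neq j$, both flippable in $I$, with $\mathsf r(I,i)=\mathsf r(I,j)$; otherwise it is double root free. -}

module Defs where

open import Level using (Level; 0ℓ; _⊔_) renaming (suc to lsuc)
open import Algebra.Apartness.Bundles using (HeytingField; module HeytingCommutativeRing)
open import Algebra.Bundles using (Group)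
import Algebra.Definitions.RawMonoid as RawMonoidDefinitions
open import Algebra.Module.Bundles using (Module)
import Algebra.Module.Definitions.Left as LeftDefinitions
open import Data.Fin.Base using (Fin) renaming (_<_ to _<ᶠ_; _≥_ to _≥ᶠ_)
open import Data.Fin.Properties using () renaming (_<?_ to _<ᶠ?_)
open import Data.Fin.Subset using (Subset; inside; outside; _∈_; _-_; _─_; ∁)
open import Data.List.Base using (List; []; _∷_; _++_; length; foldr; replicate; concat)
open import Data.List.Relation.Unary.Linked using (Linked)
open import Data.Nat.Base using (ℕ) renaming (_≤_ to _≤ℕ_)
open import Data.Product.Base using (∃; ∃₂; _×_)
open import Data.Sum.Base using (_⊎_)
open import Data.Vec.Base using (Vec; []; _∷_; lookup; tabulate)
open import Data.Vec.Functional using (Vector)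
open import Function.Bundles using (Inverse; _⇔_)
open import Relation.Binary.Core using (Rel)
open import Relation.Binary.PropositionalEquality using (_≡_; _≢_) renaming (setoid to ≡-setoid)
open import Relation.Binary.Structures using (IsStrictPartialOrder)
open import Relation.Nullary.Decidable.Core using (does)
open import Relation.Nullary.Negation.Core using (¬_)

private
  variable
    a c ℓ₁ ℓ₂ ℓ₃ v ℓv w ℓw : Level

-- The real numbers are replaced by an arbitrary ordered field.  The order is
-- not assumed decidable, so that both constructive reals and discrete fields
-- such as ℚ or the real algebraic numbers are instances; for a discrete field
-- this is the usual notion of a linearly ordered field.
record OrderedField c ℓ₁ ℓ₂ ℓ₃ : Set (lsuc (c ⊔ ℓ₁ ⊔ ℓ₂ ⊔ ℓ₃)) where
  infix 4 _<_ _≤_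
  field
    heytingField : HeytingField c ℓ₁ ℓ₂

  open HeytingField heytingField public

  field
    _<_                  : Rel Carrier ℓ₃
    isStrictPartialOrder : IsStrictPartialOrder _≈_ _<_
    #⇔<⊎>                : ∀ x y → x # y ⇔ (x < y ⊎ y < x)
    +-monoˡ-<            : ∀ {x y} z → x < y → (x + z) < (y + z)
    *-positive           : ∀ {x y} → 0# < x → 0# < y → 0# < (x * y)

  _≤_ : Rel Carrier ℓ₃
  x ≤ y = ¬ (y < x)

record EuclideanSpace (K : OrderedField c ℓ₁ ℓ₂ ℓ₃) v ℓv
                      : Set (c ⊔ ℓ₁ ⊔ ℓ₃ ⊔ lsuc (v ⊔ ℓv)) where
  open OrderedField K using (Carrier; _≈_; _+_; _*_; 0#; _≤_; heytingCommutativeRing)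
  field
    vectorSpace : Module (HeytingCommutativeRing.commutativeRing heytingCommutativeRing) v ℓv

  open Module vectorSpace public

  linearCombination : ∀ {n} → Vector Carrier n → Vector Carrierᴹ n → Carrierᴹ
  linearCombination λs vs = RawMonoidDefinitions.sum +ᴹ-rawMonoid (λ i → λs i *ₗ vs i)

  LinearlyIndependent : ∀ {n} → Vector Carrierᴹ n → Set (c ⊔ ℓ₁ ⊔ ℓv)
  LinearlyIndependent vs = ∀ λs → linearCombination λs vs ≈ᴹ 0ᴹ → ∀ i → λs i ≈ 0#

  Spanning : ∀ {n} → Vector Carrierᴹ n → Set (c ⊔ v ⊔ ℓv)
  Spanning vs = ∀ x → ∃ λ λs → x ≈ᴹ linearCombination λs vs

  field
    dimension         : ℕ
    basis             : Vector Carrierᴹ dimension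
    basis-independent : LinearlyIndependent basis
    basis-spanning    : Spanning basis

    ⟨_,_⟩          : Carrierᴹ → Carrierᴹ → Carrier
    ⟨⟩-cong        : ∀ {x x′ y y′} → x ≈ᴹ x′ → y ≈ᴹ y′ → ⟨ x , y ⟩ ≈ ⟨ x′ , y′ ⟩
    ⟨⟩-sym         : ∀ x y → ⟨ x , y ⟩ ≈ ⟨ y , x ⟩
    ⟨⟩-additive    : ∀ x y z → ⟨ x +ᴹ y , z ⟩ ≈ ⟨ x , z ⟩ + ⟨ y , z ⟩
    ⟨⟩-homogeneous : ∀ k x y → ⟨ k *ₗ x , y ⟩ ≈ k * ⟨ x , y ⟩
    ⟨⟩-nonNegative : ∀ x → 0# ≤ ⟨ x , x ⟩
    ⟨⟩-definite    : ∀ x → ⟨ x , x ⟩ ≈ 0# → x ≈ᴹ 0ᴹ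

-- Equality of words in the monoid ⟨ S ∣ (s t)^m(s,t) = 1 ⟩.  Since m(s,s) = 1
-- makes each generator an involution, this is also the group so presented.
data CoxeterCongruence {n : ℕ} (m : Fin n → Fin n → ℕ) : Rel (List (Fin n)) 0ℓ where
  relator : ∀ s t → CoxeterCongruence m (concat (replicate (m s t) (s ∷ t ∷ []))) []
  ∼-refl  : ∀ {x} → CoxeterCongruence m x x
  ∼-sym   : ∀ {x y} → CoxeterCongruence m x y → CoxeterCongruence m y x
  ∼-trans : ∀ {x y z} → CoxeterCongruence m x y → CoxeterCongruence m y z →
            CoxeterCongruence m x z
  ++-cong : ∀ {x x′ y y′} → CoxeterCongruence m x x′ → CoxeterCongruence m y y′ →
            CoxeterCongruence m (x ++ y) (x′ ++ y′)

-- In a finite Coxeter system no m(s,t) is infinite, so the Coxeter matrix has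
-- entries in ℕ.
record FiniteCoxeterSystem w ℓw : Set (lsuc (w ⊔ ℓw)) where
  field
    group : Group w ℓw

  open Group group public

  field
    rank : ℕ

  S : Set
  S = Fin rank

  field
    generator : S → Carrier

  product : List S → Carrier
  product = foldr (λ s x → generator s ∙ x) ε

  field
    coxeterMatrix     : S → S → ℕ
    matrix-diagonal   : ∀ s → coxeterMatrix s s ≡ 1
    matrix-symmetric  : ∀ s t → coxeterMatrix s t ≡ coxeterMatrix t s
    matrix-off        : ∀ s t → s ≢ t → 2 ≤ℕ coxeterMatrix s t
    generated         : ∀ x → ∃ λ u → product u ≈ x
    presented         : ∀ u u′ → product u ≈ product u′ ⇔ CoxeterCongruence coxeterMatrix u u′
    order             : ℕ
    finite            : Inverse setoid (≡-setoid (Fin order))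

  IsReducedExpression : List S → Carrier → Set ℓw
  IsReducedExpression u x =
    product u ≈ x × (∀ u′ → product u′ ≈ x → length u ≤ℕ length u′)

-- Faithfulness identifies W with a finite reflection group on V.  The root
-- system need not span V, and roots may have different lengths; Φ is finite
-- and W-stable because it is defined as the W-orbit of the simple roots.
record ReflectionAction {K : OrderedField c ℓ₁ ℓ₂ ℓ₃} (V : EuclideanSpace K v ℓv)
                        (C : FiniteCoxeterSystem w ℓw)
                        : Set (c ⊔ ℓ₁ ⊔ ℓ₃ ⊔ v ⊔ ℓv ⊔ w ⊔ ℓw) where
  private
    module K = OrderedField K
  open EuclideanSpace V
  open FiniteCoxeterSystem C using (S; generator; _∙_; ε) renaming (Carrier to W; _≈_ to _≈ᵂ_)
  open LeftDefinitions W _≈ᴹ_ using (LeftIdentity; Associative; Congruent)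

  infixr 7 _•_
  field
    _•_           : W → Carrierᴹ → Carrierᴹ
    •-cong        : Congruent _≈ᵂ_ _•_
    •-identity    : LeftIdentity ε _•_
    •-assoc       : Associative _∙_ _•_
    •-additive    : ∀ g x y → g • (x +ᴹ y) ≈ᴹ g • x +ᴹ g • y
    •-homogeneous : ∀ g k x → g • (k *ₗ x) ≈ᴹ k *ₗ (g • x)
    •-faithful    : ∀ g h → (∀ x → g • x ≈ᴹ h • x) → g ≈ᵂ h

    α           : S → Carrierᴹ
    -- The form of α s ≠ 0 that makes ⟨ α s , α s ⟩ invertible.
    α-nonzero   : ∀ s → K.0# K.< ⟨ α s , α s ⟩
    reflect-α   : ∀ s → generator s • α s ≈ᴹ -ᴹ α s
    reflect-fix : ∀ s x → ⟨ x , α s ⟩ K.≈ K.0# → generator s • x ≈ᴹ x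

  Φ : Carrierᴹ → Set (ℓv ⊔ w)
  Φ β = ∃₂ λ g s → β ≈ᴹ g • α s

  NonNegativeCombination : Carrierᴹ → Set (c ⊔ ℓ₃ ⊔ ℓv)
  NonNegativeCombination x = ∃ λ λs → (∀ s → K.0# K.≤ λs s) × x ≈ᴹ linearCombination λs α

  NonPositiveCombination : Carrierᴹ → Set (c ⊔ ℓ₃ ⊔ ℓv)
  NonPositiveCombination x = ∃ λ λs → (∀ s → λs s K.≤ K.0#) × x ≈ᴹ linearCombination λs α

  field
    Φ-reduced     : ∀ k β → Φ β → Φ (k *ₗ β) → k K.≈ K.1# ⊎ k K.≈ K.- K.1#
    α-independent : LinearlyIndependent α
    α-simple      : ∀ β → Φ β → NonNegativeCombination β ⊎ NonPositiveCombination β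

-- The letters of Q at the positions in X, in increasing order of position.
subword : ∀ {A : Set a} {m} → Vec A m → Subset m → List A
subword []      []            = []
subword (q ∷ Q) (inside  ∷ X) = q ∷ subword Q X
subword (q ∷ Q) (outside ∷ X) = subword Q X

before : ∀ {m} → Fin m → Subset m
before k = tabulate (λ x → does (x <ᶠ? k))

data Labelling : Set where
  𝗉 𝗇 : Labelling

module SubwordComplex
  {K : OrderedField c ℓ₁ ℓ₂ ℓ₃} {V : EuclideanSpace K v ℓv} {C : FiniteCoxeterSystem w ℓw}
  (R : ReflectionAction V C)
  {m : ℕ} (Q : Vec (FiniteCoxeterSystem.S C) m) (ρ : FiniteCoxeterSystem.Carrier C)
  where

  open import Relation.Binary.Construct.Closure.ReflexiveTransitive using (Star; ε; _◅_)
  open FiniteCoxeterSystem C using (product; IsReducedExpression)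
  open EuclideanSpace V using (Carrierᴹ; _≈ᴹ_)
  open ReflectionAction R using (_•_; α)

  Facet : Subset m → Set ℓw
  Facet I = IsReducedExpression (subword Q (∁ I)) ρ

  -- before k is the set written [k-1] when positions start at 1.
  rootFunction : Subset m → Fin m → Carrierᴹ
  rootFunction I k = product (subword Q (before k ─ I)) • α (lookup Q k)

  record Flip (I J : Subset m) (i j : Fin m) : Set ℓw where
    field
      facetˡ   : Facet I
      facetʳ   : Facet J
      distinct : I ≢ J
      i∈I      : i ∈ I
      j∈J      : j ∈ J
      adjacent : I - i ≡ J - j

  Flippable : Subset m → Fin m → Set ℓw
  Flippable I i = ∃₂ λ J j → Flip I J i j

  HasDoubleRoot : Set (ℓv ⊔ ℓw)
  HasDoubleRoot = ∃ λ I → Facet I × ∃₂ λ i j →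
    i ≢ j × Flippable I i × Flippable I j × rootFunction I i ≈ᴹ rootFunction I j

  DoubleRootFree : Set (ℓv ⊔ ℓw)
  DoubleRootFree = ¬ HasDoubleRoot

  infix 4 _⟶_
  record _⟶_ (I J : Subset m) : Set ℓw where
    field
      i j        : Fin m
      flip       : Flip I J i j
      increasing : i <ᶠ j

  label : Labelling → ∀ {I J} → I ⟶ J → Fin m
  label 𝗉 e = _⟶_.i e
  label 𝗇 e = _⟶_.j e

  Path : Rel (Subset m) ℓw
  Path = Star _⟶_

  pathLength : ∀ {I J} → Path I J → ℕ
  pathLength ε       = 0
  pathLength (e ◅ P) = ℕ.suc (pathLength P)

  vertices : ∀ {I J} → Path I J → List (Subset m)
  vertices {I} ε       = I ∷ []
  vertices {I} (e ◅ P) = I ∷ vertices P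

  labels : Labelling → ∀ {I J} → Path I J → List (Fin m)
  labels l ε       = []
  labels l (e ◅ P) = label l e ∷ labels l P

  Rising Falling : Labelling → ∀ {I J} → Path I J → Set
  Rising  l P = Linked _<ᶠ_ (labels l P)
  Falling l P = Linked _≥ᶠ_ (labels l P)

  -- Paths are identified when they visit the same facets: 𝒢(Q,ρ) has no
  -- multiple edges, whereas _⟶_ also carries proofs.
  IsUniqueRising : Labelling → ∀ {I J} → Path I J → Set ℓw
  IsUniqueRising l {I} {J} P =
    Rising l P × (∀ (P′ : Path I J) → Rising l P′ → vertices P′ ≡ vertices P)

  MaximalLength MinimalLength : ∀ {I J} → Path I J → Set ℓw
  MaximalLength {I} {J} P = ∀ (P′ : Path I J) → pathLength P′ ≤ℕ pathLength P
  MinimalLength {I} {J} P = ∀ (P′ : Path I J) → pathLength P ≤ℕ pathLength P′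

{-# OPTIONS --safe #-}
-- The signs of the vectors w⁻¹(β), for w running through the prefixes of a facet, change
-- only at a letter with root ±β.  This gives the exchange condition, and shows that a facet
-- has an increasing flip at y as soon as some facet agreeing with it before y does not
-- contain y.  If A → B flips i and B → B₁ flips x < i, then B₁ is the greedy sink of a
-- codimension two link, so x can be flipped first, in A → A₁, and a rising path leads from A₁
-- to B₁; it is nonempty, since otherwise i and x would be flipped to the same position of A
-- and have the same root.  Moving the flips of small positions to the front in this way turns
-- any path into a rising one without shortening it, and a rising path is determined by its
-- end points.  The same induction shows that a position that has left a facet never returns
-- along a path.  A falling path from I to J moreover never removes what it added, so its
-- length is ∣I ∖ J∣, a lower bound for every path.

module Submission where

open import Algebra.Apartness.Bundles using (module HeytingCommutativeRing)
import Algebra.Apartness.Properties.HeytingCommutativeRing as HeytingProperties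
open import Algebra.Bundles using (CommutativeMonoid; CommutativeRing)
import Algebra.Module.Properties as ModuleProperties
import Algebra.Properties.AbelianGroup as AbelianGroupProperties
import Algebra.Properties.CommutativeMonoid.Sum as CommutativeMonoidSum
import Algebra.Properties.CommutativeSemigroup as CommutativeSemigroupProperties
import Algebra.Properties.Group as GroupProperties
import Algebra.Properties.Ring as RingProperties
open import Data.Bool.Base using (false; not)
open import Data.Bool.Properties using (not-involutive)
open import Data.Fin.Base using (Fin; zero; suc; toℕ; fromℕ<; opposite)
  renaming (_<_ to _<ᶠ_; _≥_ to _≥ᶠ_)
open import Data.Fin.Properties
  using (_≟_; any?; suc-injective; toℕ-fromℕ<; toℕ<n; toℕ-injective; opposite-prop;
         opposite-involutive)
  renaming (<-trans to <ᶠ-trans)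
open import Data.Fin.Subset as Subset
  using (Subset; Side; inside; outside; _∈_; _∉_; _⊆_; _⊂_; _─_; _-_; ∁; ∣_∣; ⁅_⁆)
open import Data.Fin.Subset.Properties
  using (x∈⁅x⁆; x≢y⇒x∉⁅y⁆; p⊆q⇒∣p∣≤∣q∣; p⊂q⇒∣p∣<∣q∣; ∣⊥∣≡0)
open import Data.List.Base using (List; []; _∷_; length; concat; replicate; _ʳ++_)
open import Data.List.Properties using (reverse-injective)
open import Data.List.Relation.Unary.All as All using (All; []; _∷_)
open import Data.List.Relation.Unary.AllPairs using (AllPairs; []; _∷_)
open import Data.List.Relation.Unary.Linked using (Linked; []; [-]; _∷_)
open import Data.List.Relation.Unary.Linked.Properties using (Linked⇒AllPairs)
open import Data.Nat.Base
  using (ℕ; zero; suc; z≤n; s≤s; _≤′_; ≤′-refl; ≤′-step)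
open import Data.Nat.Properties as ℕ using (≤⇒≤′; ≤′⇒≤)
open import Data.Product.Base using (∃; ∃₂; _×_; _,_; proj₁; proj₂)
open import Data.Sum.Base using (_⊎_; inj₁; inj₂)
open import Data.Vec.Base using (Vec; []; _∷_; lookup; tabulate; zipWith; _[_]≔_)
open import Data.Vec.Functional using (Vector)
open import Data.Vec.Properties
  using (lookup⇒[]=; []=⇒lookup; lookup-map; lookup∘update; lookup∘update′; lookup-zipWith;
         tabulate∘lookup; tabulate-cong)
open import Function.Base using (_∘_; case_of_)
open import Function.Bundles using (Equivalence)
open import Level using (Level)
open import Relation.Binary.Definitions using (tri<; tri≈; tri>)
open import Relation.Binary.PropositionalEquality as ≡ using (_≡_; _≢_)
import Relation.Binary.Reasoning.Setoid as SetoidReasoning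
open import Relation.Binary.Structures using (IsStrictPartialOrder)
open import Relation.Nullary using (¬_; yes; no; contradiction)
open import Defs

-- The combinatorial half uses only the axioms `IsFlipOrder`, so one argument serves both
-- labellings: for `𝗇` all flips are reversed and positions are read from the right. Since prefixes
-- are always read from the left, those axioms that mention an order are proved in an upward and a
-- downward version.
--
-- The obstacle is to see that B₁ is a sink without classifying the links. With j the position added
-- by the flip of i and k the one added by the flip of x, every other element of B₁ lies in A, and k
-- can only be flipped back to x. For j, signs decide: if w is a prefix of length p and β the root
-- of a letter y, the sign of w⁻¹(β) depends only on whether y precedes p. Were j flipped further
-- up, it would be a letter of two facets with contradictory signs.
--
-- Double roots are a genuine threat to lengths: with one, x may be flipped in B to the position i
-- just vacated, so that A → B → B₁ ends where the single flip of x to j in A ends. Moving x to the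
-- front would then shorten the path, and i would have come back.

private
  variable
    c ℓ ℓ₁ ℓ₂ ℓ₃ v ℓv w ℓw : Level
    n : ℕ

-- Finite reflection groups

module OrderedFieldProperties (K : OrderedField c ℓ₁ ℓ₂ ℓ₃) where
  open OrderedField K
  open HeytingProperties heytingCommutativeRing using (1#0)
  open CommutativeRing (HeytingCommutativeRing.commutativeRing heytingCommutativeRing)
    using (ring)
  open RingProperties ring using (-‿involutive; -1*x≈-x)
  open IsStrictPartialOrder isStrictPartialOrder
    using (<-respˡ-≈; <-respʳ-≈) renaming (irrefl to <-irrefl; trans to <-trans)

  0<1 : 0# < 1#
  0<1 with Equivalence.to (#⇔<⊎> 1# 0#) 1#0
  ... | inj₂ 0<1 = 0<1
  ... | inj₁ 1<0 = contradiction (<-trans 0<1′ 1<0) (<-irrefl refl)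
    where
    0<-1 : 0# < - 1#
    0<-1 = <-respˡ-≈ (-‿inverseʳ 1#) (<-respʳ-≈ (+-identityˡ _) (+-monoˡ-< (- 1#) 1<0))
    0<1′ : 0# < 1#
    0<1′ = <-respʳ-≈ (trans (-1*x≈-x _) (-‿involutive 1#)) (*-positive 0<-1 0<-1)

  0≰-1 : ¬ 0# ≤ - 1#
  0≰-1 0≤-1 = 0≤-1 (<-respˡ-≈ (+-identityˡ _) (<-respʳ-≈ (-‿inverseʳ 1#) (+-monoˡ-< (- 1#) 0<1)))

  ≤-respʳ-≈ : ∀ {x y z} → y ≈ z → x ≤ y → x ≤ z
  ≤-respʳ-≈ y≈z x≤y z<x = x≤y (<-respˡ-≈ (sym y≈z) z<x)

  -- The order is not decidable, so equality comes from tightness of the apartness: `x # 0#` is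
  -- refuted on either side of `0#`.
  0≤x+y≈0⇒x≈0 : ∀ {x y} → 0# ≤ x → 0# ≤ y → x + y ≈ 0# → x ≈ 0#
  0≤x+y≈0⇒x≈0 {x} {y} 0≤x 0≤y x+y≈0 = proj₁ (tight x 0#) λ x#0 →
    case Equivalence.to (#⇔<⊎> x 0#) x#0 of λ where
      (inj₁ x<0) → 0≤x x<0
      (inj₂ 0<x) → 0≤y (<-respˡ-≈ (+-identityˡ y) (<-respʳ-≈ x+y≈0 (+-monoˡ-< y 0<x)))

  x≤0⇒0≤-x : ∀ {x} → x ≤ 0# → 0# ≤ - x
  x≤0⇒0≤-x {x} x≤0 -x<0 =
    x≤0 (<-respˡ-≈ (-‿inverseˡ x) (<-respʳ-≈ (+-identityˡ x) (+-monoˡ-< x -x<0)))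

  0<x⇒invertible : ∀ {x} → 0# < x → ∃ λ x⁻¹ → x⁻¹ * x ≈ 1#
  0<x⇒invertible {x} 0<x with #⇒invertible (Equivalence.from (#⇔<⊎> x 0#) (inj₂ 0<x))
  ... | x⁻¹ , x⁻¹[x-0]≈1 , _ =
    x⁻¹ , trans (*-congˡ (sym (HeytingProperties.x-0≈x heytingCommutativeRing x))) x⁻¹[x-0]≈1

module LinearCombinations {K : OrderedField c ℓ₁ ℓ₂ ℓ₃} (V : EuclideanSpace K v ℓv) where
  open OrderedField K using (Carrier; _≈_; _+_; 0#; -_)
  open EuclideanSpace V
  private
    module K = OrderedField K
    module Sum = CommutativeMonoidSum +ᴹ-commutativeMonoid

  linearCombination-+ : ∀ {n} (λs μs : Vector Carrier n) (vs : Vector Carrierᴹ n) →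
    linearCombination (λ t → λs t + μs t) vs ≈ᴹ linearCombination λs vs +ᴹ linearCombination μs vs
  linearCombination-+ λs μs vs = ≈ᴹ-trans
    (Sum.sum-cong-≋ (λ t → *ₗ-distribʳ (vs t) (λs t) (μs t)))
    (Sum.∑-distrib-+ (λ t → λs t *ₗ vs t) (λ t → μs t *ₗ vs t))

  linearCombination-zero : ∀ {n} {λs : Vector Carrier n} (vs : Vector Carrierᴹ n) →
    (∀ t → λs t ≈ 0#) → linearCombination λs vs ≈ᴹ 0ᴹ
  linearCombination-zero {n} vs λ≈0 = ≈ᴹ-trans
    (Sum.sum-cong-≋ (λ t → ≈ᴹ-trans (*ₗ-congʳ (λ≈0 t)) (*ₗ-zeroˡ (vs t))))
    (Sum.sum-replicate-zero n)

  linearCombination-single : ∀ {n} {λs : Vector Carrier n} (vs : Vector Carrierᴹ n) s →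
    (∀ t → t ≢ s → λs t ≈ 0#) → linearCombination λs vs ≈ᴹ λs s *ₗ vs s
  linearCombination-single vs zero λ≈0 = ≈ᴹ-trans
    (+ᴹ-congˡ (linearCombination-zero (vs ∘ suc) (λ t → λ≈0 (suc t) λ ())))
    (+ᴹ-identityʳ _)
  linearCombination-single vs (suc s) λ≈0 = ≈ᴹ-trans
    (+ᴹ-cong (≈ᴹ-trans (*ₗ-congʳ (λ≈0 zero λ ())) (*ₗ-zeroˡ (vs zero)))
             (linearCombination-single (vs ∘ suc) s (λ t t≢s → λ≈0 (suc t) (t≢s ∘ suc-injective))))
    (+ᴹ-identityˡ _)

  linearCombination-neg : ∀ {n} (λs : Vector Carrier n) (vs : Vector Carrierᴹ n) →
    linearCombination (λ t → - λs t) vs ≈ᴹ -ᴹ linearCombination λs vs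
  linearCombination-neg λs vs = ModuleProperties.inverseˡ-uniqueᴹ vectorSpace _ _
    (≈ᴹ-trans (≈ᴹ-sym (linearCombination-+ (λ t → - λs t) λs vs))
              (linearCombination-zero vs (λ t → K.-‿inverseˡ (λs t))))

  independent⇒unique : ∀ {n} {vs : Vector Carrierᴹ n} → LinearlyIndependent vs →
    ∀ {λs μs} → linearCombination λs vs ≈ᴹ linearCombination μs vs → ∀ t → λs t ≈ μs t
  independent⇒unique {vs = vs} independent {λs} {μs} eq t = begin
    λs t                    ≈⟨ K.+-identityʳ _ ⟨
    λs t + 0#               ≈⟨ K.+-congˡ (K.-‿inverseˡ (μs t)) ⟨
    λs t + (- μs t + μs t)  ≈⟨ K.+-assoc _ _ _ ⟨
    λs t + - μs t + μs t    ≈⟨ K.+-congʳ (independent (λ t → λs t + - μs t) difference t) ⟩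
    0# + μs t               ≈⟨ K.+-identityˡ _ ⟩
    μs t                    ∎
    where
    open SetoidReasoning K.setoid
    difference : linearCombination (λ t → λs t + - μs t) vs ≈ᴹ 0ᴹ
    difference = ≈ᴹ-trans (linearCombination-+ λs (λ t → - μs t) vs)
      (≈ᴹ-trans (+ᴹ-cong eq (linearCombination-neg μs vs)) (-ᴹ‿inverseʳ _))

module RootSystem {K : OrderedField c ℓ₁ ℓ₂ ℓ₃} {V : EuclideanSpace K v ℓv}
                  {C : FiniteCoxeterSystem w ℓw} (R : ReflectionAction V C) where
  open OrderedField K using (Carrier; _≈_; _+_; _*_; -_; 0#; 1#; _<_; _≤_)
  open OrderedFieldProperties K
  open EuclideanSpace V
  open LinearCombinations V
  open FiniteCoxeterSystem C
    using (S; generator; product; presented; generated; matrix-diagonal; _∙_; _⁻¹)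
    renaming (Carrier to W; _≈_ to _≈ᵂ_; ε to εᵂ)
  open ReflectionAction R
  private
    module K where
      open OrderedField K public
      open CommutativeRing (HeytingCommutativeRing.commutativeRing heytingCommutativeRing) public
        using (ring)
      open RingProperties ring public using (-‿distribˡ-*; -‿distribʳ-*; -‿involutive)
    module W where
      open FiniteCoxeterSystem C public
      open GroupProperties group public
    open ModuleProperties vectorSpace using (inverseˡ-uniqueᴹ; -ᴹ-involutive)
    open AbelianGroupProperties +ᴹ-abelianGroup using () renaming (⁻¹-∙-comm to -ᴹ-+ᴹ-comm)

  -ᴹ-*ₗ : ∀ k x → (- k) *ₗ x ≈ᴹ -ᴹ (k *ₗ x)
  -ᴹ-*ₗ k x = inverseˡ-uniqueᴹ _ _ (≈ᴹ-trans (≈ᴹ-sym (*ₗ-distribʳ x (- k) k))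
    (≈ᴹ-trans (*ₗ-congʳ (K.-‿inverseˡ k)) (*ₗ-zeroˡ x)))

  *ₗ-ᴹ : ∀ k x → k *ₗ (-ᴹ x) ≈ᴹ -ᴹ (k *ₗ x)
  *ₗ-ᴹ k x = inverseˡ-uniqueᴹ _ _ (≈ᴹ-trans (≈ᴹ-sym (*ₗ-distribˡ k (-ᴹ x) x))
    (≈ᴹ-trans (*ₗ-congˡ (-ᴹ‿inverseˡ x)) (*ₗ-zeroʳ k)))

  •-zero : ∀ g → g • 0ᴹ ≈ᴹ 0ᴹ
  •-zero g = ≈ᴹ-trans (•-cong W.refl (≈ᴹ-sym (*ₗ-zeroˡ 0ᴹ)))
    (≈ᴹ-trans (•-homogeneous g 0# 0ᴹ) (*ₗ-zeroˡ _))

  •-neg : ∀ g x → g • (-ᴹ x) ≈ᴹ -ᴹ (g • x)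
  •-neg g x = inverseˡ-uniqueᴹ _ _ (≈ᴹ-trans (≈ᴹ-sym (•-additive g (-ᴹ x) x))
    (≈ᴹ-trans (•-cong W.refl (-ᴹ‿inverseˡ x)) (•-zero g)))

  •-congˡ : ∀ {g x y} → x ≈ᴹ y → g • x ≈ᴹ g • y
  •-congˡ = •-cong W.refl

  •-congʳ : ∀ {g h x} → g ≈ᵂ h → g • x ≈ᴹ h • x
  •-congʳ g≈h = •-cong g≈h ≈ᴹ-refl

  •-inverseˡ : ∀ g x → g ⁻¹ • g • x ≈ᴹ x
  •-inverseˡ g x = ≈ᴹ-trans (≈ᴹ-sym (•-assoc (g ⁻¹) g x))
    (≈ᴹ-trans (•-congʳ (W.inverseˡ g)) (•-identity x))

  •-inverseʳ : ∀ g x → g • g ⁻¹ • x ≈ᴹ x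
  •-inverseʳ g x = ≈ᴹ-trans (≈ᴹ-sym (•-assoc g (g ⁻¹) x))
    (≈ᴹ-trans (•-congʳ (W.inverseʳ g)) (•-identity x))

  generator-involutive : ∀ s → generator s ∙ generator s ≈ᵂ εᵂ
  generator-involutive s = W.trans (W.∙-congˡ (W.sym (W.identityʳ _)))
    (Equivalence.from (presented (s ∷ s ∷ []) []) (relation (matrix-diagonal s)))
    where
    relation : ∀ {k} → W.coxeterMatrix s s ≡ k →
      CoxeterCongruence W.coxeterMatrix (concat (replicate k (s ∷ s ∷ []))) []
    relation ≡.refl = relator s s

  ⟨⟩-additiveʳ : ∀ x y z → ⟨ x , y +ᴹ z ⟩ ≈ ⟨ x , y ⟩ + ⟨ x , z ⟩
  ⟨⟩-additiveʳ x y z = K.trans (⟨⟩-sym _ _)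
    (K.trans (⟨⟩-additive y z x) (K.+-cong (⟨⟩-sym _ _) (⟨⟩-sym _ _)))

  ⟨⟩-homogeneousʳ : ∀ k x y → ⟨ x , k *ₗ y ⟩ ≈ k * ⟨ x , y ⟩
  ⟨⟩-homogeneousʳ k x y = K.trans (⟨⟩-sym _ _)
    (K.trans (⟨⟩-homogeneous k y x) (K.*-congˡ (⟨⟩-sym _ _)))

  ⟨⟩-zeroˡ : ∀ y → ⟨ 0ᴹ , y ⟩ ≈ 0#
  ⟨⟩-zeroˡ y = K.trans (⟨⟩-cong (≈ᴹ-sym (*ₗ-zeroˡ 0ᴹ)) ≈ᴹ-refl)
    (K.trans (⟨⟩-homogeneous 0# 0ᴹ y) (K.zeroˡ _))

  ⟨⟩-negʳ≈0 : ∀ {x y} → ⟨ x , y ⟩ ≈ 0# → ⟨ x , -ᴹ y ⟩ ≈ 0#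
  ⟨⟩-negʳ≈0 {x} {y} x⊥y = begin
    ⟨ x , -ᴹ y ⟩                   ≈⟨ K.+-identityʳ _ ⟨
    ⟨ x , -ᴹ y ⟩ + 0#              ≈⟨ K.+-congˡ x⊥y ⟨
    ⟨ x , -ᴹ y ⟩ + ⟨ x , y ⟩       ≈⟨ ⟨⟩-additiveʳ x (-ᴹ y) y ⟨
    ⟨ x , -ᴹ y +ᴹ y ⟩              ≈⟨ ⟨⟩-cong ≈ᴹ-refl (-ᴹ‿inverseˡ y) ⟩
    ⟨ x , 0ᴹ ⟩                     ≈⟨ ⟨⟩-sym _ _ ⟩
    ⟨ 0ᴹ , x ⟩                     ≈⟨ ⟨⟩-zeroˡ x ⟩
    0#                             ∎
    where open SetoidReasoning K.setoid

  -- The axioms of the action prescribe a generator only on `α s` and on its orthogonal complement.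
  -- The witness `a` is the projection coefficient of `x` on `α s`.
  decompose : ∀ s x → ∃₂ λ a x′ → x ≈ᴹ a *ₗ α s +ᴹ x′ × ⟨ x′ , α s ⟩ ≈ 0#
  decompose s x with 0<x⇒invertible (α-nonzero s)
  ... | d⁻¹ , d⁻¹d≈1 = a , x′ , x≈ , x′⊥α
    where
    d = ⟨ α s , α s ⟩
    a = ⟨ x , α s ⟩ * d⁻¹
    x′ = -ᴹ (a *ₗ α s) +ᴹ x
    x≈ : x ≈ᴹ a *ₗ α s +ᴹ x′
    x≈ = ≈ᴹ-sym (≈ᴹ-trans (≈ᴹ-sym (+ᴹ-assoc _ _ _))
      (≈ᴹ-trans (+ᴹ-congʳ (-ᴹ‿inverseʳ _)) (+ᴹ-identityˡ x)))
    open SetoidReasoning K.setoid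
    x′⊥α : ⟨ x′ , α s ⟩ ≈ 0#
    x′⊥α = begin
      ⟨ x′ , α s ⟩                              ≈⟨ ⟨⟩-additive _ x (α s) ⟩
      ⟨ -ᴹ (a *ₗ α s) , α s ⟩ + ⟨ x , α s ⟩      ≈⟨ K.+-congʳ (⟨⟩-cong (≈ᴹ-sym (-ᴹ-*ₗ a _)) ≈ᴹ-refl) ⟩
      ⟨ (- a) *ₗ α s , α s ⟩ + ⟨ x , α s ⟩       ≈⟨ K.+-congʳ (⟨⟩-homogeneous (- a) _ _) ⟩
      (- a) * d + ⟨ x , α s ⟩                    ≈⟨ K.+-congʳ (K.-‿distribˡ-* a d) ⟨
      - (a * d) + ⟨ x , α s ⟩                    ≈⟨ K.+-congʳ (K.-‿cong (K.*-assoc _ _ _)) ⟩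
      - (⟨ x , α s ⟩ * (d⁻¹ * d)) + ⟨ x , α s ⟩  ≈⟨ K.+-congʳ (K.-‿cong (K.*-congˡ d⁻¹d≈1)) ⟩
      - (⟨ x , α s ⟩ * 1#) + ⟨ x , α s ⟩         ≈⟨ K.+-congʳ (K.-‿cong (K.*-identityʳ _)) ⟩
      - ⟨ x , α s ⟩ + ⟨ x , α s ⟩                ≈⟨ K.-‿inverseˡ _ ⟩
      0#                                         ∎

  generator-• : ∀ s {x} a {x′} → x ≈ᴹ a *ₗ α s +ᴹ x′ → ⟨ x′ , α s ⟩ ≈ 0# →
    generator s • x ≈ᴹ (- a) *ₗ α s +ᴹ x′
  generator-• s {x} a {x′} x≈ x′⊥α = begin
    generator s • x                             ≈⟨ •-congˡ x≈ ⟩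
    generator s • (a *ₗ α s +ᴹ x′)              ≈⟨ •-additive _ _ _ ⟩
    generator s • a *ₗ α s +ᴹ generator s • x′  ≈⟨ +ᴹ-cong (•-homogeneous _ a _) (reflect-fix s x′ x′⊥α) ⟩
    a *ₗ (generator s • α s) +ᴹ x′              ≈⟨ +ᴹ-congʳ (*ₗ-congˡ (reflect-α s)) ⟩
    a *ₗ (-ᴹ α s) +ᴹ x′                         ≈⟨ +ᴹ-congʳ (*ₗ-ᴹ a (α s)) ⟩
    -ᴹ (a *ₗ α s) +ᴹ x′                         ≈⟨ +ᴹ-congʳ (-ᴹ-*ₗ a (α s)) ⟨
    (- a) *ₗ α s +ᴹ x′                          ∎
    where open SetoidReasoning ≈ᴹ-setoid

  private
    ⟨⟩-decomposed : ∀ s {x y} a b {x′ y′} →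
      x ≈ᴹ a *ₗ α s +ᴹ x′ → y ≈ᴹ b *ₗ α s +ᴹ y′ →
      ⟨ x′ , α s ⟩ ≈ 0# → ⟨ y′ , α s ⟩ ≈ 0# →
      ⟨ x , y ⟩ ≈ a * (b * ⟨ α s , α s ⟩) + ⟨ x′ , y′ ⟩
    ⟨⟩-decomposed s {x} {y} a b {x′} {y′} x≈ y≈ x′⊥α y′⊥α = begin
      ⟨ x , y ⟩                                           ≈⟨ ⟨⟩-cong x≈ ≈ᴹ-refl ⟩
      ⟨ a *ₗ α s +ᴹ x′ , y ⟩                              ≈⟨ ⟨⟩-additive _ _ _ ⟩
      ⟨ a *ₗ α s , y ⟩ + ⟨ x′ , y ⟩                       ≈⟨ K.+-cong (⟨⟩-homogeneous _ _ _) (⟨⟩-cong ≈ᴹ-refl y≈) ⟩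
      a * ⟨ α s , y ⟩ + ⟨ x′ , b *ₗ α s +ᴹ y′ ⟩           ≈⟨ K.+-cong (K.*-congˡ α-part) x′-part ⟩
      a * (b * ⟨ α s , α s ⟩) + ⟨ x′ , y′ ⟩               ∎
      where
      open SetoidReasoning K.setoid
      α-part : ⟨ α s , y ⟩ ≈ b * ⟨ α s , α s ⟩
      α-part = begin
        ⟨ α s , y ⟩                            ≈⟨ ⟨⟩-cong ≈ᴹ-refl y≈ ⟩
        ⟨ α s , b *ₗ α s +ᴹ y′ ⟩               ≈⟨ ⟨⟩-additiveʳ _ _ _ ⟩
        ⟨ α s , b *ₗ α s ⟩ + ⟨ α s , y′ ⟩      ≈⟨ K.+-cong (⟨⟩-homogeneousʳ _ _ _) (K.trans (⟨⟩-sym _ _) y′⊥α) ⟩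
        b * ⟨ α s , α s ⟩ + 0#                 ≈⟨ K.+-identityʳ _ ⟩
        b * ⟨ α s , α s ⟩                      ∎
      x′-part : ⟨ x′ , b *ₗ α s +ᴹ y′ ⟩ ≈ ⟨ x′ , y′ ⟩
      x′-part = begin
        ⟨ x′ , b *ₗ α s +ᴹ y′ ⟩            ≈⟨ ⟨⟩-additiveʳ _ _ _ ⟩
        ⟨ x′ , b *ₗ α s ⟩ + ⟨ x′ , y′ ⟩    ≈⟨ K.+-congʳ (⟨⟩-homogeneousʳ _ _ _) ⟩
        b * ⟨ x′ , α s ⟩ + ⟨ x′ , y′ ⟩     ≈⟨ K.+-congʳ (K.*-congˡ x′⊥α) ⟩
        b * 0# + ⟨ x′ , y′ ⟩               ≈⟨ K.+-congʳ (K.zeroʳ b) ⟩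
        0# + ⟨ x′ , y′ ⟩                   ≈⟨ K.+-identityˡ _ ⟩
        ⟨ x′ , y′ ⟩                        ∎

  -- Along `α s` both coefficients change sign, which cancels in their product; the orthogonal parts
  -- are fixed.
  generator-isometry : ∀ s x y → ⟨ generator s • x , generator s • y ⟩ ≈ ⟨ x , y ⟩
  generator-isometry s x y with decompose s x | decompose s y
  ... | a , x′ , x≈ , x′⊥α | b , y′ , y≈ , y′⊥α = begin
    ⟨ generator s • x , generator s • y ⟩
      ≈⟨ ⟨⟩-decomposed s (- a) (- b) (generator-• s a x≈ x′⊥α) (generator-• s b y≈ y′⊥α) x′⊥α y′⊥α ⟩
    (- a) * ((- b) * d) + ⟨ x′ , y′ ⟩
      ≈⟨ K.+-congʳ (K.trans (K.sym (K.-‿distribˡ-* a _))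
           (K.-‿cong (K.trans (K.*-congˡ (K.sym (K.-‿distribˡ-* b d))) (K.sym (K.-‿distribʳ-* a _))))) ⟩
    - (- (a * (b * d))) + ⟨ x′ , y′ ⟩
      ≈⟨ K.+-congʳ (K.-‿involutive _) ⟩
    a * (b * d) + ⟨ x′ , y′ ⟩
      ≈⟨ ⟨⟩-decomposed s a b x≈ y≈ x′⊥α y′⊥α ⟨
    ⟨ x , y ⟩ ∎
    where
    open SetoidReasoning K.setoid
    d = ⟨ α s , α s ⟩

  isometry : ∀ g x y → ⟨ g • x , g • y ⟩ ≈ ⟨ x , y ⟩
  isometry g x y with generated g
  ... | u , u≈g = K.trans (⟨⟩-cong (•-congʳ (W.sym u≈g)) (•-congʳ (W.sym u≈g))) (word u)
    where
    word : ∀ u → ⟨ product u • x , product u • y ⟩ ≈ ⟨ x , y ⟩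
    word []      = ⟨⟩-cong (•-identity x) (•-identity y)
    word (s ∷ u) = K.trans (⟨⟩-cong (•-assoc _ _ x) (•-assoc _ _ y))
      (K.trans (generator-isometry s _ _) (word u))

  Positive : Carrierᴹ → Set _
  Positive = NonNegativeCombination

  Positive-resp : ∀ {x y} → x ≈ᴹ y → Positive x → Positive y
  Positive-resp x≈y (λs , 0≤λ , x≈) = λs , 0≤λ , ≈ᴹ-trans (≈ᴹ-sym x≈y) x≈

  Φ-resp : ∀ {x y} → x ≈ᴹ y → Φ x → Φ y
  Φ-resp x≈y (g , s , x≈) = g , s , ≈ᴹ-trans (≈ᴹ-sym x≈y) x≈

  Φ-• : ∀ g {x} → Φ x → Φ (g • x)
  Φ-• g (h , s , x≈) = g ∙ h , s , ≈ᴹ-trans (•-congˡ x≈) (≈ᴹ-sym (•-assoc g h _))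

  Φ-α : ∀ s → Φ (α s)
  Φ-α s = εᵂ , s , ≈ᴹ-sym (•-identity _)

  Φ-neg : ∀ {x} → Φ x → Φ (-ᴹ x)
  Φ-neg (g , s , x≈) = g ∙ generator s , s , ≈ᴹ-sym
    (≈ᴹ-trans (•-assoc g (generator s) (α s))
    (≈ᴹ-trans (•-congˡ (reflect-α s))
    (≈ᴹ-trans (•-neg g _) (-ᴹ‿cong (≈ᴹ-sym x≈)))))

  sign : ∀ {x} → Φ x → Positive x ⊎ Positive (-ᴹ x)
  sign {x} Φx with α-simple x Φx
  ... | inj₁ x>0              = inj₁ x>0
  ... | inj₂ (λs , λ≤0 , x≈) = inj₂ ((λ t → - λs t) , (λ t → x≤0⇒0≤-x (λ≤0 t)) ,
    ≈ᴹ-trans (-ᴹ‿cong x≈) (≈ᴹ-sym (linearCombination-neg λs α)))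

  private
    multipleOf : S → Carrier → Vector Carrier W.rank
    multipleOf s k t with t ≟ s
    ... | yes _ = k
    ... | no  _ = 0#

    multipleOf-≢ : ∀ s k t → t ≢ s → multipleOf s k t ≈ 0#
    multipleOf-≢ s k t t≢s with t ≟ s
    ... | yes t≡s = contradiction t≡s t≢s
    ... | no  _   = K.refl

    multipleOf-≡ : ∀ s k → multipleOf s k s ≈ k
    multipleOf-≡ s k with s ≟ s
    ... | yes _  = K.refl
    ... | no s≢s = contradiction ≡.refl s≢s

    linearCombination-multipleOf : ∀ s k → linearCombination (multipleOf s k) α ≈ᴹ k *ₗ α s
    linearCombination-multipleOf s k = ≈ᴹ-trans
      (linearCombination-single α s (multipleOf-≢ s k)) (*ₗ-congʳ (multipleOf-≡ s k))

    -- By independence the coefficients of `x` and `y` add up to those of `k *ₗ α s`; where that sum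
    -- is zero, nonnegative terms must vanish.
    coefficients-cancel : ∀ {x y s k} ((λs , _) : Positive x) → Positive y → x +ᴹ y ≈ᴹ k *ₗ α s →
      ∀ t → multipleOf s k t ≈ 0# → λs t ≈ 0#
    coefficients-cancel {s = s} {k} (λs , 0≤λ , x≈) (μs , 0≤μ , y≈) x+y≈ t kₜ≈0 =
      0≤x+y≈0⇒x≈0 (0≤λ t) (0≤μ t) (K.trans
        (independent⇒unique α-independent
          (≈ᴹ-trans (linearCombination-+ λs μs α)
          (≈ᴹ-trans (+ᴹ-cong (≈ᴹ-sym x≈) (≈ᴹ-sym y≈))
          (≈ᴹ-trans x+y≈ (≈ᴹ-sym (linearCombination-multipleOf s k))))) t)
        kₜ≈0)

  α-positive : ∀ s → Positive (α s)
  α-positive s with sign (Φ-α s)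
  ... | inj₁ α>0 = α>0
  ... | inj₂ (λs , 0≤λ , -α≈) = contradiction (≤-respʳ-≈ λₛ≈-1 (0≤λ s)) 0≰-1
    where
    λₛ≈-1 : λs s ≈ - 1#
    λₛ≈-1 = K.trans
      (independent⇒unique α-independent
        (≈ᴹ-trans (≈ᴹ-sym -α≈)
        (≈ᴹ-trans (-ᴹ‿cong (≈ᴹ-sym (*ₗ-identityˡ (α s))))
        (≈ᴹ-trans (≈ᴹ-sym (-ᴹ-*ₗ 1# (α s)))
        (≈ᴹ-sym (linearCombination-multipleOf s (- 1#)))))) s)
      (multipleOf-≡ s (- 1#))

  ¬positive×negative : ∀ {x} → Φ x → Positive x → ¬ Positive (-ᴹ x)
  ¬positive×negative {x} (g , s , x≈gα) x>0@(λs , _ , x≈) -x>0 =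
    IsStrictPartialOrder.irrefl K.isStrictPartialOrder (K.sym α²≈0) (α-nonzero s)
    where
    x≈0 : x ≈ᴹ 0ᴹ
    x≈0 = ≈ᴹ-trans x≈ (linearCombination-zero α λ t → coefficients-cancel {s = s} x>0 -x>0
      (≈ᴹ-trans (-ᴹ‿inverseʳ x) (≈ᴹ-sym (*ₗ-zeroˡ (α s)))) t (zero-multiple t))
      where
      zero-multiple : ∀ t → multipleOf s 0# t ≈ 0#
      zero-multiple t with t ≟ s
      ... | yes _ = K.refl
      ... | no  _ = K.refl
    α≈0 : α s ≈ᴹ 0ᴹ
    α≈0 = ≈ᴹ-trans (≈ᴹ-sym (•-inverseˡ g (α s)))
      (≈ᴹ-trans (•-congˡ (≈ᴹ-trans (≈ᴹ-sym x≈gα) x≈0)) (•-zero _))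
    α²≈0 : ⟨ α s , α s ⟩ ≈ 0#
    α²≈0 = K.trans (⟨⟩-cong α≈0 ≈ᴹ-refl) (⟨⟩-zeroˡ _)

  -- `x` and its image differ by a multiple of `α s`, so the other coefficients of `x` cannot change
  -- sign without being zero. Among the multiples of `α s`, `Φ-reduced` leaves two, and positivity
  -- excludes the negative one.
  only-α-made-negative : ∀ s {x} → Φ x → Positive x → Positive (-ᴹ (generator s • x)) → x ≈ᴹ α s
  only-α-made-negative s {x} Φx x>0@(λs , 0≤λ , x≈) -sx>0 with decompose s x
  ... | a , x′ , x≈a , x′⊥α = case Φ-reduced (λs s) (α s) (Φ-α s) (Φ-resp x≈λα Φx) of λ where
      (inj₁ λₛ≈1)  → ≈ᴹ-trans x≈λα (≈ᴹ-trans (*ₗ-congʳ λₛ≈1) (*ₗ-identityˡ (α s)))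
      (inj₂ λₛ≈-1) → contradiction (≤-respʳ-≈ λₛ≈-1 (0≤λ s)) 0≰-1
    where
    open SetoidReasoning ≈ᴹ-setoid
    x-sx≈ : x +ᴹ -ᴹ (generator s • x) ≈ᴹ (a + a) *ₗ α s
    x-sx≈ = begin
      x +ᴹ -ᴹ (generator s • x)                        ≈⟨ +ᴹ-cong x≈a (-ᴹ‿cong (generator-• s a x≈a x′⊥α)) ⟩
      (a *ₗ α s +ᴹ x′) +ᴹ -ᴹ ((- a) *ₗ α s +ᴹ x′)      ≈⟨ +ᴹ-congˡ (-ᴹ-+ᴹ-comm _ _) ⟨
      (a *ₗ α s +ᴹ x′) +ᴹ (-ᴹ ((- a) *ₗ α s) +ᴹ -ᴹ x′) ≈⟨ +ᴹ-congˡ (+ᴹ-congʳ (-ᴹ‿cong (-ᴹ-*ₗ a _))) ⟩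
      (a *ₗ α s +ᴹ x′) +ᴹ (-ᴹ (-ᴹ (a *ₗ α s)) +ᴹ -ᴹ x′) ≈⟨ +ᴹ-congˡ (+ᴹ-congʳ (-ᴹ-involutive _)) ⟩
      (a *ₗ α s +ᴹ x′) +ᴹ (a *ₗ α s +ᴹ -ᴹ x′)          ≈⟨ interchange _ _ _ _ ⟩
      (a *ₗ α s +ᴹ a *ₗ α s) +ᴹ (x′ +ᴹ -ᴹ x′)          ≈⟨ +ᴹ-cong (≈ᴹ-sym (*ₗ-distribʳ _ a a)) (-ᴹ‿inverseʳ x′) ⟩
      (a + a) *ₗ α s +ᴹ 0ᴹ                             ≈⟨ +ᴹ-identityʳ _ ⟩
      (a + a) *ₗ α s                                   ∎
      where open CommutativeSemigroupProperties (CommutativeMonoid.commutativeSemigroup +ᴹ-commutativeMonoid) using (interchange)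
    x≈λα : x ≈ᴹ λs s *ₗ α s
    x≈λα = ≈ᴹ-trans x≈ (linearCombination-single α s λ t t≢s →
      coefficients-cancel {s = s} x>0 -sx>0 x-sx≈ t (multipleOf-≢ s (a + a) t t≢s))

  reflection : W → S → W
  reflection g s = g ∙ generator s ∙ g ⁻¹

  reflection-• : ∀ g s x → reflection g s • x ≈ᴹ g • generator s • g ⁻¹ • x
  reflection-• g s x = ≈ᴹ-trans (•-assoc _ _ x) (•-assoc g (generator s) _)

  reflection-negates : ∀ g s → reflection g s • g • α s ≈ᴹ -ᴹ (g • α s)
  reflection-negates g s = begin
    reflection g s • g • α s            ≈⟨ reflection-• g s _ ⟩
    g • generator s • g ⁻¹ • g • α s    ≈⟨ •-congˡ (•-congˡ (•-inverseˡ g _)) ⟩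
    g • generator s • α s               ≈⟨ •-congˡ (reflect-α s) ⟩
    g • (-ᴹ α s)                        ≈⟨ •-neg g _ ⟩
    -ᴹ (g • α s)                        ∎
    where open SetoidReasoning ≈ᴹ-setoid

  reflection-fixes : ∀ g s x → ⟨ x , g • α s ⟩ ≈ 0# → reflection g s • x ≈ᴹ x
  reflection-fixes g s x x⊥gα = begin
    reflection g s • x            ≈⟨ reflection-• g s x ⟩
    g • generator s • g ⁻¹ • x    ≈⟨ •-congˡ (reflect-fix s _ g⁻¹x⊥α) ⟩
    g • g ⁻¹ • x                  ≈⟨ •-inverseʳ g x ⟩
    x                             ∎
    where
    open SetoidReasoning ≈ᴹ-setoid
    g⁻¹x⊥α : ⟨ g ⁻¹ • x , α s ⟩ ≈ 0#
    g⁻¹x⊥α = K.trans (K.sym (isometry g _ _))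
      (K.trans (⟨⟩-cong (•-inverseʳ g x) ≈ᴹ-refl) x⊥gα)

  EqualUpToSign : Carrierᴹ → Carrierᴹ → Set _
  EqualUpToSign x y = x ≈ᴹ y ⊎ x ≈ᴹ -ᴹ y

  -- The action is faithful, so the elements are compared on vectors: both negate `g • α s` and fix
  -- its orthogonal complement. The splitting of `x` is the image under `g` of that of `g ⁻¹ • x`.
  equalUpToSign⇒reflection-≈ : ∀ g s h r → EqualUpToSign (g • α s) (h • α r) →
    reflection g s ≈ᵂ reflection h r
  equalUpToSign⇒reflection-≈ g s h r gα≈±hα = •-faithful _ _ λ x →
    let a , y , y≈ , y⊥α = decompose s (g ⁻¹ • x)
        x≈ : x ≈ᴹ a *ₗ (g • α s) +ᴹ g • y
        x≈ = ≈ᴹ-trans (≈ᴹ-sym (•-inverseʳ g x)) (≈ᴹ-trans (•-congˡ y≈)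
               (≈ᴹ-trans (•-additive g _ _) (+ᴹ-congʳ (•-homogeneous g a _))))
        gy⊥gα = K.trans (isometry g y (α s)) y⊥α
    in begin
      reflection g s • x                                  ≈⟨ split (reflection g s) x≈ ⟩
      a *ₗ (reflection g s • g • α s) +ᴹ reflection g s • g • y
        ≈⟨ +ᴹ-cong (*ₗ-congˡ (reflection-negates g s)) (reflection-fixes g s _ gy⊥gα) ⟩
      a *ₗ (-ᴹ (g • α s)) +ᴹ g • y
        ≈⟨ +ᴹ-cong (*ₗ-congˡ negates) (reflection-fixes h r _ (orthogonal gα≈±hα gy⊥gα)) ⟨
      a *ₗ (reflection h r • g • α s) +ᴹ reflection h r • g • y ≈⟨ split (reflection h r) x≈ ⟨
      reflection h r • x                                  ∎
    where
    open SetoidReasoning ≈ᴹ-setoid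
    split : ∀ k {a x y z} → x ≈ᴹ a *ₗ y +ᴹ z → k • x ≈ᴹ a *ₗ (k • y) +ᴹ k • z
    split k x≈ = ≈ᴹ-trans (•-congˡ x≈)
      (≈ᴹ-trans (•-additive k _ _) (+ᴹ-congʳ (•-homogeneous k _ _)))
    negates : reflection h r • g • α s ≈ᴹ -ᴹ (g • α s)
    negates = case gα≈±hα of λ where
      (inj₁ gα≈hα)  → ≈ᴹ-trans (•-congˡ gα≈hα) (≈ᴹ-trans (reflection-negates h r) (-ᴹ‿cong (≈ᴹ-sym gα≈hα)))
      (inj₂ gα≈-hα) → ≈ᴹ-trans (•-congˡ gα≈-hα) (≈ᴹ-trans (•-neg _ _)
        (-ᴹ‿cong (≈ᴹ-trans (reflection-negates h r) (≈ᴹ-sym gα≈-hα))))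
    orthogonal : ∀ {y} → EqualUpToSign (g • α s) (h • α r) → ⟨ y , g • α s ⟩ ≈ 0# → ⟨ y , h • α r ⟩ ≈ 0#
    orthogonal (inj₁ gα≈hα) y⊥  = K.trans (⟨⟩-cong ≈ᴹ-refl (≈ᴹ-sym gα≈hα)) y⊥
    orthogonal (inj₂ gα≈-hα) y⊥ = K.trans
      (⟨⟩-cong ≈ᴹ-refl (≈ᴹ-trans (≈ᴹ-sym (-ᴹ-involutive _)) (-ᴹ‿cong (≈ᴹ-sym gα≈-hα))))
      (⟨⟩-negʳ≈0 y⊥)

  -- Pulled back by `h`, the root `g • α s` becomes a root `x` negated by `generator r`. Whichever
  -- of `x` and `-ᴹ x` is positive is made negative by this generator, hence equals `α r`.
  reflection-≈⇒equalUpToSign : ∀ g s h r → reflection g s ≈ᵂ reflection h r →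
    EqualUpToSign (g • α s) (h • α r)
  reflection-≈⇒equalUpToSign g s h r eq = case sign Φx of λ where
      (inj₁ x>0)  → inj₁ (transport (only-α-made-negative r Φx x>0
                      (Positive-resp (≈ᴹ-sym -rx≈x) x>0)))
      (inj₂ -x>0) → inj₂ (transport′ (only-α-made-negative r (Φ-neg Φx) -x>0
                      (Positive-resp (-ᴹ‿cong (≈ᴹ-sym (≈ᴹ-trans (•-neg _ _) -rx≈x))) -x>0)))
    where
    open SetoidReasoning ≈ᴹ-setoid
    x = h ⁻¹ • g • α s
    Φx : Φ x
    Φx = Φ-• (h ⁻¹) (Φ-• g (Φ-α s))
    rx≈-x : generator r • x ≈ᴹ -ᴹ x
    rx≈-x = begin
      generator r • x                          ≈⟨ •-inverseˡ h _ ⟨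
      h ⁻¹ • h • generator r • x               ≈⟨ •-congˡ (reflection-• h r _) ⟨
      h ⁻¹ • reflection h r • g • α s          ≈⟨ •-congˡ (•-congʳ (W.sym eq)) ⟩
      h ⁻¹ • reflection g s • g • α s          ≈⟨ •-congˡ (reflection-negates g s) ⟩
      h ⁻¹ • (-ᴹ (g • α s))                    ≈⟨ •-neg _ _ ⟩
      -ᴹ x                                     ∎
    -rx≈x : -ᴹ (generator r • x) ≈ᴹ x
    -rx≈x = ≈ᴹ-trans (-ᴹ‿cong rx≈-x) (-ᴹ-involutive x)
    transport : ∀ {y} → x ≈ᴹ y → g • α s ≈ᴹ h • y
    transport x≈y = ≈ᴹ-trans (≈ᴹ-sym (•-inverseʳ h _)) (•-congˡ x≈y)
    transport′ : ∀ {y} → -ᴹ x ≈ᴹ y → g • α s ≈ᴹ -ᴹ (h • y)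
    transport′ -x≈y = ≈ᴹ-trans (transport (≈ᴹ-trans (≈ᴹ-sym (-ᴹ-involutive x)) (-ᴹ‿cong -x≈y)))
      (•-neg h _)

-- Subsets of positions

open import Data.Nat.Base using (_+_; _∸_; _<_; _≤_)

lookup-injective : {A : Set ℓ} {xs ys : Vec A n} → (∀ k → lookup xs k ≡ lookup ys k) → xs ≡ ys
lookup-injective {xs = xs} {ys} eq =
  ≡.trans (≡.sym (tabulate∘lookup xs)) (≡.trans (tabulate-cong eq) (tabulate∘lookup ys))

∉⇒lookup≡outside : ∀ {X : Subset n} {k} → k ∉ X → lookup X k ≡ outside
∉⇒lookup≡outside {X = X} {k} k∉X with lookup X k in eq
... | inside  = contradiction (lookup⇒[]= k X eq) k∉X
... | outside = ≡.refl

lookup≡outside⇒∉ : ∀ {X : Subset n} {k} → lookup X k ≡ outside → k ∉ X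
lookup≡outside⇒∉ eq k∈X with () ← ≡.trans (≡.sym eq) ([]=⇒lookup k∈X)

inside≢outside : ∀ {X : Subset n} {k} → lookup X k ≡ inside → lookup X k ≢ outside
inside≢outside eq eq′ with () ← ≡.trans (≡.sym eq) eq′

lookup-∁ : ∀ (X : Subset n) k → lookup (∁ X) k ≡ not (lookup X k)
lookup-∁ X k = lookup-map k not X

update₂ : {A : Set ℓ} → Vec A n → Fin n → A → Fin n → A → Vec A n
update₂ xs y b z c = xs [ y ]≔ b [ z ]≔ c

module _ {A : Set ℓ} (xs : Vec A n) {y z : Fin n} {b c : A} where
  lookup-update₂-fst : y ≢ z → lookup (update₂ xs y b z c) y ≡ b
  lookup-update₂-fst y≢z = ≡.trans (lookup∘update′ y≢z (xs [ y ]≔ b) c) (lookup∘update y xs b)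

  lookup-update₂-snd : lookup (update₂ xs y b z c) z ≡ c
  lookup-update₂-snd = lookup∘update z (xs [ y ]≔ b) c

  lookup-update₂-else : ∀ k → k ≢ y → k ≢ z → lookup (update₂ xs y b z c) k ≡ lookup xs k
  lookup-update₂-else k k≢y k≢z = ≡.trans (lookup∘update′ k≢z (xs [ y ]≔ b) c) (lookup∘update′ k≢y xs b)

∣p∣≤1+∣p[x]≔outside∣ : ∀ (p : Subset n) x → ∣ p ∣ ≤ suc ∣ p [ x ]≔ outside ∣
∣p∣≤1+∣p[x]≔outside∣ (inside ∷ p)  zero    = ℕ.≤-refl
∣p∣≤1+∣p[x]≔outside∣ (outside ∷ p) zero    = ℕ.n≤1+n _
∣p∣≤1+∣p[x]≔outside∣ (inside ∷ p)  (suc x) = s≤s (∣p∣≤1+∣p[x]≔outside∣ p x)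
∣p∣≤1+∣p[x]≔outside∣ (outside ∷ p) (suc x) = ∣p∣≤1+∣p[x]≔outside∣ p x

∣p∣≤1+∣q∣ : ∀ {p q : Subset n} x → (∀ {k} → k ≢ x → k ∈ p → k ∈ q) → ∣ p ∣ ≤ suc ∣ q ∣
∣p∣≤1+∣q∣ {p = p} {q} x p⊆q =
  ℕ.≤-trans (∣p∣≤1+∣p[x]≔outside∣ p x) (s≤s (p⊆q⇒∣p∣≤∣q∣ p[x]⊆q))
  where
  p[x]⊆q : p [ x ]≔ outside ⊆ q
  p[x]⊆q {k} k∈ with k ≟ x
  ... | yes ≡.refl = contradiction k∈ (lookup≡outside⇒∉ (lookup∘update k p outside))
  ... | no  k≢x    = p⊆q k≢x (lookup⇒[]= k p
    (≡.trans (≡.sym (lookup∘update′ k≢x p outside)) ([]=⇒lookup k∈)))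

length-subword : ∀ {A : Set ℓ} (Q : Vec A n) X → length (subword Q X) ≡ ∣ X ∣
length-subword []      []            = ≡.refl
length-subword (q ∷ Q) (inside  ∷ X) = ≡.cong suc (length-subword Q X)
length-subword (q ∷ Q) (outside ∷ X) = length-subword Q X

lookup-zipWith-inside : ∀ (d : Side → Side → Side) → (∀ x → d x inside ≡ outside) →
  ∀ (p q : Subset n) k → lookup q k ≡ inside → lookup (zipWith d p q) k ≡ outside
lookup-zipWith-inside d d-in p q k eq rewrite lookup-zipWith d k p q | eq = d-in _

lookup-zipWith-outside : ∀ (d : Side → Side → Side) → (∀ x → d x outside ≡ x) →
  ∀ (p q : Subset n) k → lookup q k ≡ outside → lookup (zipWith d p q) k ≡ lookup p k
lookup-zipWith-outside d d-out p q k eq rewrite lookup-zipWith d k p q | eq = d-out _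

lookup-removed : ∀ (p : Subset n) k → lookup (p - k) k ≡ outside
lookup-removed p k = lookup-zipWith-inside _ (λ _ → ≡.refl) p ⁅ k ⁆ k ([]=⇒lookup (x∈⁅x⁆ k))

lookup-kept : ∀ (p : Subset n) x k → k ≢ x → lookup (p - x) k ≡ lookup p k
lookup-kept p x k k≢x = lookup-zipWith-outside _ (λ _ → ≡.refl) p ⁅ x ⁆ k (∉⇒lookup≡outside (x≢y⇒x∉⁅y⁆ k≢x))

-- Increasing flip graphs

module _ {m : ℕ} (Facet : Subset m → Set ℓ) where

  -- Pointwise form of `Flip`. It carries no direction: an increasing flip is an `Exchange` with a
  -- separate inequality of positions, so that the same data can be read backwards.
  record Exchange (X Y : Subset m) (x y : Fin m) : Set ℓ where
    field
      facetˡ    : Facet X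
      facetʳ    : Facet Y
      x∈X       : lookup X x ≡ inside
      x∉Y       : lookup Y x ≡ outside
      y∈Y       : lookup Y y ≡ inside
      y∉X       : lookup X y ≡ outside
      elsewhere : ∀ k → k ≢ x → k ≢ y → lookup Y k ≡ lookup X k

  exchange-sym : ∀ {X Y x y} → Exchange X Y x y → Exchange Y X y x
  exchange-sym exchange = record
    { facetˡ = facetʳ ; facetʳ = facetˡ ; x∈X = y∈Y ; x∉Y = y∉X ; y∈Y = x∈X ; y∉X = x∉Y
    ; elsewhere = λ k k≢y k≢x → ≡.sym (elsewhere k k≢x k≢y) }
    where open Exchange exchange

  -- Reversing all flips and the order of the positions exchanges the labellings 𝗉 and 𝗇,
  -- so everything about 𝗇 follows by using these axioms for the opposite order.
  record IsFlipOrder (pos : Fin m → ℕ) : Set ℓ where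
    field
      pos-injective   : ∀ {i j} → pos i ≡ pos j → i ≡ j
      pos<m           : ∀ i → pos i < m
      exchange-unique : ∀ {X Y Z x y z} → Exchange X Y x y → Exchange X Z x z → y ≡ z
      exchangeable    : ∀ {X Y y} → Facet X → Facet Y →
                        (∀ k → pos k < pos y → lookup X k ≡ lookup Y k) →
                        lookup X y ≡ inside → lookup Y y ≡ outside →
                        ∃₂ λ Z k → Exchange X Z y k × pos y < pos k
      no-return       : ∀ {A B B₁ Z i j x k z} →
                        Exchange A B i j → pos i < pos j → Exchange B B₁ x k → pos x < pos k →
                        pos x < pos i → Exchange B₁ Z j z → ¬ pos j < pos z
      same-target     : ∀ {X Y Z x y z} → Exchange X Y x z → Exchange X Z y z →
                        pos x < pos z → pos y < pos z → x ≡ y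

-- Walks and rises in a flip order

module Walks {m : ℕ} {Facet : Subset m → Set ℓ} {pos : Fin m → ℕ}
             (isFlipOrder : IsFlipOrder Facet pos) where
  open IsFlipOrder isFlipOrder
  private
    _⟨_↦_⟩_ : Subset m → Fin m → Fin m → Subset m → Set ℓ
    X ⟨ x ↦ y ⟩ Y = Exchange Facet X Y x y
    module E {X Y x y} (e : Exchange Facet X Y x y) = Exchange e

    variable
      X Y Z A B : Subset m
      i j k x y : Fin m
      p : ℕ

  infix 4 _≺_
  _≺_ : Fin m → Fin m → Set
  i ≺ j = pos i < pos j

  ≺⇒≢ : i ≺ j → i ≢ j
  ≺⇒≢ i≺j ≡.refl = ℕ.<-irrefl ≡.refl i≺j

  ∈-≢ : ∀ X → lookup X i ≡ inside → lookup X j ≡ outside → i ≢ j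
  ∈-≢ X i∈X j∉X ≡.refl = inside≢outside {X = X} i∈X j∉X

  -- The lower bound `p` on the labels is the parameter of the inductions, which run down from
  -- `p = m`, where no label is available. Being only a bound, it lets walks be concatenated.
  data Walk (p : ℕ) : Subset m → Subset m → ℕ → Set ℓ where
    []   : Walk p X X 0
    step : X ⟨ i ↦ j ⟩ Y → i ≺ j → p ≤ pos i → Walk p Y Z n → Walk p X Z (suc n)

  data Rise (p : ℕ) : Subset m → Subset m → ℕ → Set ℓ where
    []   : Rise p X X 0
    step : X ⟨ i ↦ j ⟩ Y → i ≺ j → p ≤ pos i → Rise (suc (pos i)) Y Z n → Rise p X Z (suc n)

  walk-≤ : ∀ {p q} → p ≤ q → Walk q X Z n → Walk p X Z n
  walk-≤ p≤q []                     = []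
  walk-≤ p≤q (step e i≺j q≤i walk) = step e i≺j (ℕ.≤-trans p≤q q≤i) (walk-≤ p≤q walk)

  rise-≤ : ∀ {p q} → p ≤ q → Rise q X Z n → Rise p X Z n
  rise-≤ p≤q []                     = []
  rise-≤ p≤q (step e i≺j q≤i rise) = step e i≺j (ℕ.≤-trans p≤q q≤i) rise

  rise⇒walk : Rise p X Z n → Walk p X Z n
  rise⇒walk []                     = []
  rise⇒walk (step e i≺j p≤i rise) =
    step e i≺j p≤i (walk-≤ (ℕ.≤-trans p≤i (ℕ.n≤1+n _)) (rise⇒walk rise))

  _++ʷ_ : ∀ {n₁ n₂} → Walk p X Y n₁ → Walk p Y Z n₂ → Walk p X Z (n₁ + n₂)
  []                     ++ʷ walk′ = walk′
  (step e i≺j p≤i walk) ++ʷ walk′ = step e i≺j p≤i (walk ++ʷ walk′)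

  walk-unchanged : pos x < p → Walk p X Z n → lookup Z x ≡ lookup X x
  walk-unchanged x<p []                     = ≡.refl
  walk-unchanged {x = x} x<p (step e i≺j p≤i walk) = ≡.trans (walk-unchanged x<p walk)
    (E.elsewhere e x (≺⇒≢ x≺i) (≺⇒≢ (ℕ.<-trans x≺i i≺j)))
    where x≺i = ℕ.<-≤-trans x<p p≤i

  -- Every flip adds a position beyond its label, hence beyond `x`; so `x` never enters and is never
  -- flipped.
  walk-suc : lookup X x ≡ outside → Walk (pos x) X Z n → Walk (suc (pos x)) X Z n
  walk-suc x∉X [] = []
  walk-suc {X} {x = x} x∉X (step {i = i} e i≺j x≤i walk) with x ≟ i
  ... | yes ≡.refl = contradiction x∉X (inside≢outside {X = X} (E.x∈X e))
  ... | no  x≢i    = step e i≺j x≺i (walk-suc (≡.trans (E.elsewhere e x x≢i (≺⇒≢ (ℕ.<-trans x≺i i≺j))) x∉X) walk)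
    where x≺i = ℕ.≤∧≢⇒< x≤i (x≢i ∘ pos-injective)

  -- A walk only adds positions beyond its labels, so p leaves at most once.
  data Split (p : ℕ) (X Z : Subset m) (n : ℕ) : Set ℓ where
    never : Walk (suc p) X Z n → Split p X Z n
    once  : ∀ {n₁ n₂} → pos x ≡ p → Walk (suc p) X A n₁ → A ⟨ x ↦ k ⟩ B → x ≺ k →
            Walk (suc p) B Z n₂ → n ≡ n₁ + suc n₂ → Split p X Z n

  split : Walk p X Z n → Split p X Z n
  split []                                      = never []
  split (step e i≺j p≤i walk) with ℕ.m≤n⇒m<n∨m≡n p≤i
  ... | inj₂ ≡.refl = once ≡.refl [] e i≺j (walk-suc (E.x∉Y e) walk) ≡.refl
  ... | inj₁ p<i with split walk
  ...   | never walk′                          = never (step e i≺j p<i walk′)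
  ...   | once eq walk₁ e′ x≺k walk₂ ≡.refl    = once eq (step e i≺j p<i walk₁) e′ x≺k walk₂ ≡.refl

  -- The lexicographically greedy walk; the hypothesis on Z says that Z is the sink of
  -- the increasing flip graph of the link of a common face of X and Z.
  rise-to-sink : ∀ d p → d + p ≡ m → Facet X → Facet Z →
    (∀ k → pos k < p → lookup X k ≡ lookup Z k) →
    (∀ {Y k l} → Z ⟨ k ↦ l ⟩ Y → k ≺ l → lookup X k ≡ inside) →
    ∃ (Rise p X Z)
  rise-to-sink {X = X} {Z} zero p ≡.refl _ _ agree _ =
    0 , ≡.subst (λ Y → Rise p X Y 0) (lookup-injective λ k → agree k (pos<m k)) []
  rise-to-sink {X = X} {Z} (suc d) p d+p≡m X-facet Z-facet agree sink
    with any? (λ k → pos k ℕ.≟ p)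
  ... | no ∄p = let _ , rise = rise-to-sink d (suc p) (≡.trans (ℕ.+-suc d p) d+p≡m) X-facet Z-facet agree′ sink
                in _ , rise-≤ (ℕ.n≤1+n p) rise
    where
    agree′ : ∀ k → pos k < suc p → lookup X k ≡ lookup Z k
    agree′ k (s≤s k≤p) = agree k (ℕ.≤∧≢⇒< k≤p λ k≡p → ∄p (k , k≡p))
  ... | yes (y , ≡.refl) = cases (lookup X y) (lookup Z y) ≡.refl ≡.refl
    where
    extend : ∀ X → (∀ k → pos k < pos y → lookup X k ≡ lookup Z k) → lookup X y ≡ lookup Z y →
      ∀ k → pos k < suc (pos y) → lookup X k ≡ lookup Z k
    extend X agree agreeʸ k (s≤s k≤y) with k ≟ y
    ... | yes ≡.refl = agreeʸ
    ... | no  k≢y    = agree k (ℕ.≤∧≢⇒< k≤y (k≢y ∘ pos-injective))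
    skip : lookup X y ≡ lookup Z y → ∃ (Rise (pos y) X Z)
    skip agreeʸ = let _ , rise = rise-to-sink d (suc (pos y)) (≡.trans (ℕ.+-suc d _) d+p≡m) X-facet Z-facet
                                   (extend X agree agreeʸ) sink
                  in _ , rise-≤ (ℕ.n≤1+n _) rise
    cases : ∀ b c → lookup X y ≡ b → lookup Z y ≡ c → ∃ (Rise (pos y) X Z)
    cases inside  inside  y∈X y∈Z = skip (≡.trans y∈X (≡.sym y∈Z))
    cases outside outside y∉X y∉Z = skip (≡.trans y∉X (≡.sym y∉Z))
    -- `exchangeable` with `X` and `Z` swapped flips `y` upward in `Z`, which by the sink hypothesis
    -- forces `y` into `X`.
    cases outside inside  y∉X y∈Z =
      let _ , _ , e , y≺l = exchangeable Z-facet X-facet (λ k k≺y → ≡.sym (agree k k≺y)) y∈Z y∉X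
      in contradiction y∉X (inside≢outside {X = X} (sink e y≺l))
    cases inside  outside y∈X y∉Z =
      let X′ , l , e , y≺l = exchangeable X-facet Z-facet agree y∈X y∉Z
          _ , rise = rise-to-sink d (suc (pos y)) (≡.trans (ℕ.+-suc d _) d+p≡m) (E.facetʳ e) Z-facet
            (extend X′ (λ k k≺y → ≡.trans (E.elsewhere e k (≺⇒≢ k≺y) (≺⇒≢ (ℕ.<-trans k≺y y≺l))) (agree k k≺y))
                    (≡.trans (E.x∉Y e) (≡.sym y∉Z)))
            -- The sink hypothesis passes to `X′`: a position flippable upward in `Z` is neither
            -- `y`, which `Z` lacks, nor `l`, which `X` lacks.
            (λ {_} {k} e′ k≺ → ≡.trans (E.elsewhere e k (∈-≢ Z (E.x∈X e′) y∉Z)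
              (∈-≢ X (sink e′ k≺) (E.y∉X e))) (sink e′ k≺))
      in _ , step e y≺l ℕ.≤-refl rise

  -- B₁ is a sink in the link of A - x - i, hence reachable after flipping x first; the
  -- walk from A₁ to B₁ is trivial only for a double root.
  diamond : ∀ {A B B₁ i j x k} → A ⟨ i ↦ j ⟩ B → i ≺ j → B ⟨ x ↦ k ⟩ B₁ → x ≺ k → x ≺ i →
    ∃₂ λ A₁ l → A ⟨ x ↦ l ⟩ A₁ × x ≺ l × ∃ λ n → Rise (suc (pos x)) A₁ B₁ (suc n)
  diamond {A} {B} {B₁} {i} {j} {x} {k} AB i≺j BB₁ x≺k x≺i =
    A₁ , l , AA₁ , x≺l , nontrivial (rise-to-sink (m ∸ suc (pos x)) (suc (pos x)) (ℕ.m∸n+n≡m (pos<m x))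
      (E.facetʳ AA₁) (E.facetʳ BB₁) agree sink)
    where
    x≺j : x ≺ j
    x≺j = ℕ.<-trans x≺i i≺j
    x∈A : lookup A x ≡ inside
    x∈A = ≡.trans (≡.sym (E.elsewhere AB x (≺⇒≢ x≺i) (≺⇒≢ x≺j))) (E.x∈X BB₁)
    below : ∀ z → z ≺ x → lookup A z ≡ lookup B₁ z
    below z z≺x = ≡.sym (≡.trans (E.elsewhere BB₁ z (≺⇒≢ z≺x) (≺⇒≢ (ℕ.<-trans z≺x x≺k)))
      (E.elsewhere AB z (≺⇒≢ (ℕ.<-trans z≺x x≺i)) (≺⇒≢ (ℕ.<-trans z≺x x≺j))))
    flip-x = exchangeable (E.facetˡ AB) (E.facetʳ BB₁) below x∈A (E.x∉Y BB₁)
    A₁ = proj₁ flip-x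
    l = proj₁ (proj₂ flip-x)
    AA₁ : A ⟨ x ↦ l ⟩ A₁
    AA₁ = proj₁ (proj₂ (proj₂ flip-x))
    x≺l : x ≺ l
    x≺l = proj₂ (proj₂ (proj₂ flip-x))
    kept : ∀ {z} → z ≢ x → lookup A z ≡ inside → lookup A₁ z ≡ inside
    kept z≢x z∈A = ≡.trans (E.elsewhere AA₁ _ z≢x (∈-≢ A z∈A (E.y∉X AA₁))) z∈A
    agree : ∀ z → pos z < suc (pos x) → lookup A₁ z ≡ lookup B₁ z
    agree z (s≤s z≤x) with z ≟ x
    ... | yes ≡.refl = ≡.trans (E.x∉Y AA₁) (≡.sym (E.x∉Y BB₁))
    ... | no  z≢x    = ≡.trans (E.elsewhere AA₁ z z≢x (≺⇒≢ (ℕ.<-trans z≺x x≺l))) (below z z≺x)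
      where
      z≺x : z ≺ x
      z≺x = ℕ.≤∧≢⇒< z≤x (z≢x ∘ pos-injective)
    sink : ∀ {Y z y} → B₁ ⟨ z ↦ y ⟩ Y → z ≺ y → lookup A₁ z ≡ inside
    sink {z = z} e z≺y with z ≟ k | z ≟ j
    -- `k` can only flip back to `x`, which precedes it; `j` is excluded by `no-return`; every other
    -- element of `B₁` comes from `A` and survives in `A₁`.
    ... | yes ≡.refl | _ = contradiction (≡.subst (_ ≺_) (≡.sym (exchange-unique (exchange-sym Facet BB₁) e)) z≺y)
                             (ℕ.<-asym x≺k)
    ... | no  z≢k    | yes ≡.refl = contradiction z≺y (no-return AB i≺j BB₁ x≺k x≺i e)
    ... | no  z≢k    | no  z≢j    = kept z≢x (≡.trans (≡.sym (E.elsewhere AB z (∈-≢ B z∈B (E.x∉Y AB)) z≢j)) z∈B)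
      where
      z≢x = ∈-≢ B₁ (E.x∈X e) (E.x∉Y BB₁)
      z∈B = ≡.trans (≡.sym (E.elsewhere BB₁ z z≢x z≢k)) (E.x∈X e)
    nontrivial : ∃ (Rise (suc (pos x)) A₁ B₁) → ∃ λ n → Rise (suc (pos x)) A₁ B₁ (suc n)
    nontrivial (suc n , rise) = n , rise
    -- An empty rise identifies `A₁` with `B₁`, which contains `j`; as `j` is not in `A`, it is the
    -- position `l` to which `x` was flipped.
    nontrivial (zero , rise) = contradiction
      (same-target AB (≡.subst (λ l → A ⟨ x ↦ l ⟩ A₁) (≡.sym j≡l) AA₁) i≺j x≺j) (≺⇒≢ x≺i ∘ ≡.sym)
      where
      A₁≡B₁ : ∀ {X Y} → Rise p X Y 0 → X ≡ Y
      A₁≡B₁ [] = ≡.refl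
      j∈A₁ : lookup A₁ j ≡ inside
      j∈A₁ = ≡.trans (≡.cong (λ X → lookup X j) (A₁≡B₁ rise)) (≡.trans
        (E.elsewhere BB₁ j (≺⇒≢ x≺j ∘ ≡.sym) (∈-≢ B (E.y∈Y AB) (E.y∉X BB₁))) (E.y∈Y AB))
      j≡l : j ≡ l
      j≡l with j ≟ l
      ... | yes eq = eq
      ... | no j≢l = contradiction (≡.trans (E.elsewhere AA₁ j (≺⇒≢ x≺j ∘ ≡.sym) j≢l) (E.y∉X AB))
        (inside≢outside {X = A₁} j∈A₁)

  -- The flip of `x` crosses the walk from its end to its start. Each `diamond` trades one flip for
  -- a nonempty rise, whence `n ≤ n′`.
  flip-earlier : Walk (suc (pos x)) A B n → ∀ {B₁ k} → B ⟨ x ↦ k ⟩ B₁ → x ≺ k →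
    ∃₂ λ A₁ l → A ⟨ x ↦ l ⟩ A₁ × x ≺ l × ∃ λ n′ → Walk (suc (pos x)) A₁ B₁ n′ × n ≤ n′
  flip-earlier []                     BB₁ x≺k = _ , _ , BB₁ , x≺k , _ , [] , z≤n
  flip-earlier (step e i≺j x<i walk) BB₁ x≺k =
    let _ , _ , e₁ , x≺l , n₁ , walk₁ , n≤n₁ = flip-earlier walk BB₁ x≺k
        _ , _ , e₀ , x≺l₀ , n₀ , rise = diamond e i≺j e₁ x≺l x<i
    in _ , _ , e₀ , x≺l₀ , _ , rise⇒walk rise ++ʷ walk₁ , s≤s (ℕ.≤-trans n≤n₁ (ℕ.m≤n+m n₁ n₀))

  -- `d` counts the label values from `p` on. The flip at `p`, if there is one, moves to the front
  -- by `flip-earlier`; what follows it then has labels beyond `p` and is at least as long as the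
  -- remaining flips were.
  rise-longest : ∀ d p → d + p ≡ m → Walk p X Z n → ∃ λ n′ → Rise p X Z n′ × n ≤ n′
  rise-longest d p d+p≡m [] = 0 , [] , z≤n
  rise-longest zero p ≡.refl (step {i = i} _ _ m≤i _) = contradiction m≤i (ℕ.<⇒≱ (pos<m i))
  rise-longest (suc d) p d+p≡m walk@(step _ _ _ _) with split walk
  ... | never walk′ =
    let _ , rise , n≤n′ = rise-longest d (suc p) (≡.trans (ℕ.+-suc d p) d+p≡m) walk′
    in _ , rise-≤ (ℕ.n≤1+n p) rise , n≤n′
  ... | once {n₁ = n₁} {n₂} ≡.refl walk₁ e x≺k walk₂ eq =
    let _ , _ , e′ , x≺l , n₁′ , walk₁′ , n₁≤n₁′ = flip-earlier walk₁ e x≺k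
        n′ , rise , ≤n′ = rise-longest d (suc p) (≡.trans (ℕ.+-suc d p) d+p≡m) (walk₁′ ++ʷ walk₂)
    in _ , step e′ x≺l ℕ.≤-refl rise ,
       ℕ.≤-trans (ℕ.≤-reflexive (≡.trans eq (ℕ.+-suc n₁ n₂))) (s≤s (ℕ.≤-trans (ℕ.+-monoˡ-≤ n₂ n₁≤n₁′) ≤n′))

  riseVertices : Rise p X Z n → List (Subset m)
  riseVertices {X = X} []               = X ∷ []
  riseVertices {X = X} (step _ _ _ rise) = X ∷ riseVertices rise

  rise-≤-vertices : ∀ {p q} (p≤q : p ≤ q) (rise : Rise q X Z n) →
    riseVertices (rise-≤ p≤q rise) ≡ riseVertices rise
  rise-≤-vertices p≤q []                = ≡.refl
  rise-≤-vertices p≤q (step _ _ _ rise) = ≡.refl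

  private
    rise-keeps : ∀ {q} → pos x ≤ q → Rise (suc q) X Z n → lookup Z x ≡ lookup X x
    rise-keeps x≤q rise = walk-unchanged (s≤s x≤q) (rise⇒walk rise)

    rise-empty : (rise : Rise p X X n) → riseVertices rise ≡ X ∷ []
    rise-empty [] = ≡.refl
    rise-empty {X = X} (step e _ _ rise) =
      contradiction (≡.trans (rise-keeps ℕ.≤-refl rise) (E.x∉Y e)) (inside≢outside {X = X} (E.x∈X e))

    -- If `i ≺ i′`, then `i` is missing from `Z`, having left at the first flip of one rise, and
    -- present in `Z`, since the other rise touches only positions beyond it.
    label-≤ : ∀ {Y′ i′ j′ n′} → X ⟨ i ↦ j ⟩ Y → Rise (suc (pos i)) Y Z n →
      X ⟨ i′ ↦ j′ ⟩ Y′ → i′ ≺ j′ → Rise (suc (pos i′)) Y′ Z n′ → ¬ i ≺ i′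
    label-≤ {X = X} {i} {Z = Z} e rise e′ i′≺j′ rise′ i≺i′ = inside≢outside {X = X} (E.x∈X e)
      (≡.trans (≡.sym (E.elsewhere e′ i (≺⇒≢ i≺i′) (≺⇒≢ (ℕ.<-trans i≺i′ i′≺j′))))
      (≡.trans (≡.sym (rise-keeps (ℕ.<⇒≤ i≺i′) rise′)) (≡.trans (rise-keeps ℕ.≤-refl rise) (E.x∉Y e))))

    exchange-functional : ∀ {Y′ j′} → X ⟨ i ↦ j ⟩ Y → X ⟨ i ↦ j′ ⟩ Y′ → Y ≡ Y′
    exchange-functional {i = i} {j} e e′ with ≡.refl ← exchange-unique e e′ = lookup-injective same
      where
      same : ∀ k → _
      same k with k ≟ i | k ≟ j
      ... | yes ≡.refl | _          = ≡.trans (E.x∉Y e) (≡.sym (E.x∉Y e′))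
      ... | no  _      | yes ≡.refl = ≡.trans (E.y∈Y e) (≡.sym (E.y∈Y e′))
      ... | no  k≢i    | no  k≢j    = ≡.trans (E.elsewhere e k k≢i k≢j) (≡.sym (E.elsewhere e′ k k≢i k≢j))

  rise-unique : ∀ {q n′} (rise : Rise p X Z n) (rise′ : Rise q X Z n′) → riseVertices rise ≡ riseVertices rise′
  rise-unique []                        rise′ = ≡.sym (rise-empty rise′)
  rise-unique rise@(step _ _ _ _)      []    = rise-empty rise
  rise-unique (step {i = i} e i≺j _ rise) (step {i = i′} e′ i′≺j′ _ rise′) with ℕ.<-cmp (pos i) (pos i′)
  ... | tri< i≺i′ _ _ = contradiction i≺i′ (label-≤ e rise e′ i′≺j′ rise′)
  ... | tri> _ _ i′≺i = contradiction i′≺i (label-≤ e′ rise′ e i≺j rise)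
  ... | tri≈ _ i≡i′ _ with ≡.refl ← pos-injective i≡i′ with ≡.refl ← exchange-functional e e′ =
    ≡.cong (_ ∷_) (rise-unique rise rise′)

  -- If i came back, pushing the flip of the smallest position x to the front would leave a
  -- walk among facets without x along which, by induction, i never leaves; so i leaves and
  -- returns only because x is flipped to i, and then x and i are flipped to the same j.
  private
    NoReentry : ℕ → Set _
    NoReentry p = ∀ {X Y Z i j n} → X ⟨ i ↦ j ⟩ Y → i ≺ j → p ≤ pos i → Walk p Y Z n → lookup Z i ≡ outside

    -- `i` is flipped out somewhere on the first walk, and `NoReentry` applies to that flip and all
    -- that follows it on both walks.
    no-reentry-walk : NoReentry p → ∀ {n′} → Walk p X Y n → Walk p Y Z n′ →
      lookup X i ≡ inside → lookup Y i ≡ outside → lookup Z i ≡ outside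
    no-reentry-walk {X = X} no-reentry [] walk′ i∈X i∉X = contradiction i∉X (inside≢outside {X = X} i∈X)
    no-reentry-walk {X = X} {i = i} no-reentry (step {i = i′} {j′} {Y = X′} e i≺j p≤i walk) walk′ i∈X i∉Y with i ≟ i′
    ... | yes ≡.refl = no-reentry e i≺j p≤i (walk ++ʷ walk′)
    ... | no  i≢i′   = no-reentry-walk no-reentry walk walk′
      (≡.trans (E.elsewhere e i i≢i′ (∈-≢ X i∈X (E.y∉X e))) i∈X) i∉Y

    no-reentry′ : ∀ d p → d + p ≡ m → NoReentry p
    no-reentry′ zero    p ≡.refl {i = i} _ _ m≤i _ = contradiction m≤i (ℕ.<⇒≱ (pos<m i))
    no-reentry′ (suc d) p d+p≡m {X} {Y} {Z} {i} {j} XY i≺j p≤i walk with ℕ.m≤n⇒m<n∨m≡n p≤i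
    ... | inj₂ ≡.refl = ≡.trans (walk-unchanged ℕ.≤-refl (walk-suc (E.x∉Y XY) walk)) (E.x∉Y XY)
    ... | inj₁ p<i with split walk
    ...   | never walk′ = no-reentry′ d (suc p) (≡.trans (ℕ.+-suc d p) d+p≡m) XY i≺j p<i walk′
    ...   | once {x = x} ≡.refl walk₁ e x≺k walk₂ _
      with Y₁ , k₁ , YY₁ , x≺k₁ , _ , walk₁′ , _ ← flip-earlier walk₁ e x≺k
      with X₁ , k₀ , XX₁ , x≺k₀ , _ , rise ← diamond XY i≺j YY₁ x≺k₁ p<i
      with lookup Y₁ i in Y₁ᵢ
    ...     | outside = no-reentry-walk (no-reentry′ d (suc p) (≡.trans (ℕ.+-suc d p) d+p≡m))
      (rise⇒walk rise) (walk₁′ ++ʷ walk₂)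
      (≡.trans (E.elsewhere XX₁ i (≺⇒≢ p<i ∘ ≡.sym) (∈-≢ X (E.x∈X XY) (E.y∉X XX₁))) (E.x∈X XY)) Y₁ᵢ
    ...     | inside = contradiction (same-target XY XY₁ i≺j x≺j) (≺⇒≢ p<i ∘ ≡.sym)
      where
      x≺j : x ≺ j
      x≺j = ℕ.<-trans p<i i≺j
      i≡k₁ : i ≡ k₁
      i≡k₁ with i ≟ k₁
      ... | yes eq   = eq
      ... | no  i≢k₁ = contradiction (≡.trans (E.elsewhere YY₁ i (≺⇒≢ p<i ∘ ≡.sym) i≢k₁) (E.x∉Y XY))
        (inside≢outside {X = Y₁} Y₁ᵢ)
      XY₁ : X ⟨ x ↦ j ⟩ Y₁
      XY₁ = record
        { facetˡ = E.facetˡ XY ; facetʳ = E.facetʳ YY₁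
        ; x∈X = ≡.trans (≡.sym (E.elsewhere XY x (≺⇒≢ p<i) (≺⇒≢ x≺j))) (E.x∈X YY₁)
        ; x∉Y = E.x∉Y YY₁
        ; y∈Y = ≡.trans (E.elsewhere YY₁ j (≺⇒≢ x≺j ∘ ≡.sym) (∈-≢ Y (E.y∈Y XY) (E.y∉X YY₁))) (E.y∈Y XY)
        ; y∉X = E.y∉X XY
        ; elsewhere = elsewhere
        }
        where
        elsewhere : ∀ z → z ≢ x → z ≢ j → lookup Y₁ z ≡ lookup X z
        elsewhere z z≢x z≢j with z ≟ i
        ... | yes ≡.refl = ≡.trans Y₁ᵢ (≡.sym (E.x∈X XY))
        ... | no  z≢i    = ≡.trans (E.elsewhere YY₁ z z≢x (λ z≡k₁ → z≢i (≡.trans z≡k₁ (≡.sym i≡k₁))))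
          (E.elsewhere XY z z≢i z≢j)

  no-reentry : X ⟨ i ↦ j ⟩ Y → i ≺ j → Walk 0 Y Z n → lookup Z i ≡ outside
  no-reentry e i≺j walk = no-reentry′ m 0 (ℕ.+-identityʳ m) e i≺j z≤n walk

-- Reduced subwords and root functions

module Prefixes {K : OrderedField c ℓ₁ ℓ₂ ℓ₃} {V : EuclideanSpace K v ℓv}
                {C : FiniteCoxeterSystem w ℓw} (R : ReflectionAction V C) where
  open EuclideanSpace V
  open FiniteCoxeterSystem C
    using (S; generator; product; _∙_; _⁻¹; ε)
    renaming (Carrier to W; _≈_ to _≈ᵂ_)
  open ReflectionAction R
  open RootSystem R
  private
    module W where
      open FiniteCoxeterSystem C public
      open GroupProperties group public

  -- A facet lists the omitted positions, so its elements contribute `ε`.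
  letter : Side → S → W
  letter inside  q = ε
  letter outside q = generator q

  letter-not : ∀ b q → letter (not b) q ≈ᵂ generator q ∙ letter b q
  letter-not inside  q = W.sym (W.identityʳ _)
  letter-not outside q = W.sym (generator-involutive q)

  -- The element w of the root function r(X,k) = w(α_k) is prefix Q X k.
  prefix : Vec S n → Subset n → ℕ → W
  prefix _       _       zero    = ε
  prefix []      []      (suc p) = ε
  prefix (q ∷ Q) (b ∷ X) (suc p) = letter b q ∙ prefix Q X p

  prefix-suc : ∀ (Q : Vec S n) X k →
    prefix Q X (suc (toℕ k)) ≈ᵂ prefix Q X (toℕ k) ∙ letter (lookup X k) (lookup Q k)
  prefix-suc (q ∷ Q) (b ∷ X) zero    = W.trans (W.identityʳ _) (W.sym (W.identityˡ _))
  prefix-suc (q ∷ Q) (b ∷ X) (suc k) =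
    W.trans (W.∙-congˡ (prefix-suc Q X k)) (W.sym (W.assoc _ _ _))

  prefix-all : ∀ (Q : Vec S n) X → prefix Q X n ≈ᵂ product (subword Q (∁ X))
  prefix-all []      []            = W.refl
  prefix-all (q ∷ Q) (inside  ∷ X) = W.trans (W.identityˡ _) (prefix-all Q X)
  prefix-all (q ∷ Q) (outside ∷ X) = W.∙-congˡ (prefix-all Q X)

  -- _─_ is a zipWith of a function that depends on both subsets, so the
  -- induction is carried out for an arbitrary such function.
  prefix-zipWith : ∀ (d : Side → Side → Side) → (∀ x → d x inside ≡ outside) → (∀ x → d x outside ≡ x) →
    ∀ (Q : Vec S n) X k → prefix Q X (toℕ k) ≈ᵂ product (subword Q (zipWith d (before k) X))
  prefix-zipWith d d-in d-out (q ∷ Q) (inside ∷ X) (suc k) rewrite d-in inside =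
    W.trans (W.identityˡ _) (prefix-zipWith d d-in d-out Q X k)
  prefix-zipWith d d-in d-out (q ∷ Q) (outside ∷ X) (suc k) rewrite d-out inside =
    W.∙-congˡ (prefix-zipWith d d-in d-out Q X k)
  prefix-zipWith d d-in d-out Q X zero = W.reflexive (none Q X)
    where
    none : ∀ {n} (Q : Vec S n) X → ε ≡ product (subword Q (zipWith d (tabulate (λ x → false)) X))
    none []      []            = ≡.refl
    none (q ∷ Q) (inside  ∷ X) rewrite d-in outside = none Q X
    none (q ∷ Q) (outside ∷ X) rewrite d-out outside = none Q X

  prefix-before : ∀ (Q : Vec S n) X k → prefix Q X (toℕ k) ≈ᵂ product (subword Q (before k ─ X))
  prefix-before Q X k = prefix-zipWith _ (λ _ → ≡.refl) (λ _ → ≡.refl) Q X k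

-- Prefix products and sign changes

module Positions {K : OrderedField c ℓ₁ ℓ₂ ℓ₃} {V : EuclideanSpace K v ℓv}
                 {C : FiniteCoxeterSystem w ℓw} (R : ReflectionAction V C)
                 {m : ℕ} (Q : Vec (FiniteCoxeterSystem.S C) m) where
  open EuclideanSpace V
  open FiniteCoxeterSystem C using (generator; _∙_; _⁻¹; ε) renaming (Carrier to W; _≈_ to _≈ᵂ_)
  open ReflectionAction R
  open RootSystem R
  open Prefixes R
  private
    module W where
      open FiniteCoxeterSystem C public
      open GroupProperties group public

  P : Subset m → ℕ → W
  P = prefix Q

  root : Subset m → Fin m → Carrierᴹ
  root X k = P X (toℕ k) • α (lookup Q k)

  rootReflection : Subset m → Fin m → W
  rootReflection X k = reflection (P X (toℕ k)) (lookup Q k)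

  Φ-root : ∀ X k → Φ (root X k)
  Φ-root X k = P X (toℕ k) , lookup Q k , ≈ᴹ-refl

  AgreeBetween : ℕ → ℕ → Subset m → Subset m → Set
  AgreeBetween p p′ X Y = ∀ k → p ≤ toℕ k → toℕ k < p′ → lookup Y k ≡ lookup X k

  private
    at : ∀ {p} → p < m → ∃ λ (k : Fin m) → p ≡ toℕ k
    at p<m = fromℕ< p<m , ≡.sym (toℕ-fromℕ< p<m)

  -- Letters multiply on the right, so a left factor `g` persists as long as the letters agree.
  translate : ∀ {X Y p p′} g → p ≤′ p′ → p′ ≤ m → AgreeBetween p p′ X Y →
    P Y p ≈ᵂ g ∙ P X p → P Y p′ ≈ᵂ g ∙ P X p′
  translate g ≤′-refl _ _ eq = eq
  translate {X} {Y} {p} g (≤′-step {p′} p≤p′) p′<m agree eq with at p′<m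
  ... | k , ≡.refl = begin
    P Y (suc (toℕ k))                           ≈⟨ prefix-suc Q Y k ⟩
    P Y (toℕ k) ∙ letter (lookup Y k) _          ≈⟨ W.∙-cong IH (W.reflexive (≡.cong (λ b → letter b _) (agree k (≤′⇒≤ p≤p′) ℕ.≤-refl))) ⟩
    (g ∙ P X (toℕ k)) ∙ letter (lookup X k) _    ≈⟨ W.assoc _ _ _ ⟩
    g ∙ (P X (toℕ k) ∙ letter (lookup X k) _)    ≈⟨ W.∙-congˡ (prefix-suc Q X k) ⟨
    g ∙ P X (suc (toℕ k))                        ∎
    where
    open SetoidReasoning W.setoid
    IH = translate g p≤p′ (ℕ.<⇒≤ p′<m) (λ k p≤k k<p′ → agree k p≤k (ℕ.m≤n⇒m≤1+n k<p′)) eq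

  translate⁻¹ : ∀ {X Y p p′} → p ≤′ p′ → p′ ≤ m → AgreeBetween p p′ X Y →
    P Y p′ ≈ᵂ P X p′ → P Y p ≈ᵂ P X p
  translate⁻¹ {X} {Y} {p} {p′} p≤p′ p′≤m agree eq = begin
    P Y p                         ≈⟨ W.//-rightDividesˡ (P X p) (P Y p) ⟨
    (P Y p ∙ P X p ⁻¹) ∙ P X p    ≈⟨ W.∙-congʳ g≈ε ⟩
    ε ∙ P X p                     ≈⟨ W.identityˡ _ ⟩
    P X p                         ∎
    where
    open SetoidReasoning W.setoid
    g≈ε : P Y p ∙ P X p ⁻¹ ≈ᵂ ε
    g≈ε = W.identityˡ-unique _ (P X p′)
      (W.trans (W.sym (translate (P Y p ∙ P X p ⁻¹) p≤p′ p′≤m agree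
        (W.sym (W.//-rightDividesˡ (P X p) (P Y p))))) eq)

  agreeBetween⇒≈ : ∀ {X Y p p′} → p ≤′ p′ → p′ ≤ m → AgreeBetween p p′ X Y →
    P Y p ≈ᵂ P X p → P Y p′ ≈ᵂ P X p′
  agreeBetween⇒≈ p≤p′ p′≤m agree eq = W.trans
    (translate ε p≤p′ p′≤m agree (W.trans eq (W.sym (W.identityˡ _)))) (W.identityˡ _)

  reflection-absorb : ∀ g s h → reflection g s ∙ (g ∙ h) ≈ᵂ g ∙ (generator s ∙ h)
  reflection-absorb g s h = W.trans (W.assoc _ _ _)
    (W.trans (W.∙-congˡ (W.\\-leftDividesʳ g h)) (W.assoc _ _ _))

  reflection-involutive : ∀ g s → reflection g s ∙ reflection g s ≈ᵂ ε
  reflection-involutive g s = begin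
    reflection g s ∙ reflection g s                  ≈⟨ W.∙-congˡ (W.assoc _ _ _) ⟩
    reflection g s ∙ (g ∙ (generator s ∙ g ⁻¹))      ≈⟨ reflection-absorb g s _ ⟩
    g ∙ (generator s ∙ (generator s ∙ g ⁻¹))         ≈⟨ W.∙-congˡ (W.assoc _ _ _) ⟨
    g ∙ (generator s ∙ generator s ∙ g ⁻¹)           ≈⟨ W.∙-congˡ (W.∙-congʳ (generator-involutive s)) ⟩
    g ∙ (ε ∙ g ⁻¹)                                   ≈⟨ W.∙-congˡ (W.identityˡ _) ⟩
    g ∙ g ⁻¹                                         ≈⟨ W.inverseʳ g ⟩
    ε                                                ∎
    where open SetoidReasoning W.setoid

  -- It leaves open which of `y` and `z` belong to `X`, and so covers flips in both directions as
  -- well as the omission of two letters.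
  record Toggled (X Y : Subset m) (y z : Fin m) : Set where
    field
      y<z       : toℕ y < toℕ z
      lookup-y  : lookup Y y ≡ not (lookup X y)
      lookup-z  : lookup Y z ≡ not (lookup X z)
      elsewhere : ∀ k → k ≢ y → k ≢ z → lookup Y k ≡ lookup X k

  module _ {X Y y z} (toggled : Toggled X Y y z) where
    open Toggled toggled

    private
      letter-at : ∀ {k} → lookup Y k ≡ not (lookup X k) →
        letter (lookup Y k) (lookup Q k) ≈ᵂ generator (lookup Q k) ∙ letter (lookup X k) (lookup Q k)
      letter-at {k} eq rewrite eq = letter-not (lookup X k) (lookup Q k)

      afterʸ : AgreeBetween (suc (toℕ y)) (toℕ z) X Y
      afterʸ k y<k k<z = elsewhere k (λ { ≡.refl → ℕ.<-irrefl ≡.refl y<k }) (λ { ≡.refl → ℕ.<-irrefl ≡.refl k<z })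

      afterᶻ : ∀ p → AgreeBetween (suc (toℕ z)) p X Y
      afterᶻ _ k z<k _ = elsewhere k (λ { ≡.refl → ℕ.<-asym y<z z<k }) (λ { ≡.refl → ℕ.<-irrefl ≡.refl z<k })

    prefix-≤ : ∀ {p} → p ≤ toℕ y → P Y p ≈ᵂ P X p
    prefix-≤ p≤y = agreeBetween⇒≈ (≤⇒≤′ z≤n) (ℕ.≤-trans p≤y (ℕ.<⇒≤ (toℕ<n y)))
      (λ k _ k<p → elsewhere k (λ { ≡.refl → ℕ.<⇒≱ k<p p≤y })
        (λ { ≡.refl → ℕ.<⇒≱ k<p (ℕ.≤-trans p≤y (ℕ.<⇒≤ y<z)) })) W.refl

    prefix-between : ∀ {p} → toℕ y < p → p ≤ toℕ z → P Y p ≈ᵂ rootReflection X y ∙ P X p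
    prefix-between y<p p≤z = translate _ (≤⇒≤′ y<p) (ℕ.≤-trans p≤z (ℕ.<⇒≤ (toℕ<n z)))
      (λ k y<k k<p → afterʸ k y<k (ℕ.<-≤-trans k<p p≤z))
      (begin
        P Y (suc (toℕ y))                                      ≈⟨ prefix-suc Q Y y ⟩
        P Y (toℕ y) ∙ letter (lookup Y y) _                     ≈⟨ W.∙-cong (prefix-≤ ℕ.≤-refl) (letter-at lookup-y) ⟩
        P X (toℕ y) ∙ (generator _ ∙ letter (lookup X y) _)     ≈⟨ reflection-absorb _ _ _ ⟨
        rootReflection X y ∙ (P X (toℕ y) ∙ letter (lookup X y) _) ≈⟨ W.∙-congˡ (prefix-suc Q X y) ⟨
        rootReflection X y ∙ P X (suc (toℕ y))                  ∎)
      where open SetoidReasoning W.setoid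

    private
      -- Both reflections are computed in `X`: the toggle at `z` happens behind the prefix
      -- `tʸ ∙ P X (toℕ z)`, so its reflection lands to the right of `tʸ`. The product is thus
      -- preserved exactly when the two reflections cancel.
      prefix-after : P Y (suc (toℕ z)) ≈ᵂ (rootReflection X y ∙ rootReflection X z) ∙ P X (suc (toℕ z))
      prefix-after = begin
        P Y (suc (toℕ z))                                      ≈⟨ prefix-suc Q Y z ⟩
        P Y (toℕ z) ∙ letter (lookup Y z) _                     ≈⟨ W.∙-cong (prefix-between y<z ℕ.≤-refl) (letter-at lookup-z) ⟩
        (tʸ ∙ P X (toℕ z)) ∙ (generator _ ∙ letter (lookup X z) _) ≈⟨ W.assoc _ _ _ ⟩
        tʸ ∙ (P X (toℕ z) ∙ (generator _ ∙ letter (lookup X z) _)) ≈⟨ W.∙-congˡ (reflection-absorb _ _ _) ⟨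
        tʸ ∙ (tᶻ ∙ (P X (toℕ z) ∙ letter (lookup X z) _))      ≈⟨ W.assoc _ _ _ ⟨
        (tʸ ∙ tᶻ) ∙ (P X (toℕ z) ∙ letter (lookup X z) _)      ≈⟨ W.∙-congˡ (prefix-suc Q X z) ⟨
        (tʸ ∙ tᶻ) ∙ P X (suc (toℕ z))                          ∎
        where
        open SetoidReasoning W.setoid
        tʸ = rootReflection X y
        tᶻ = rootReflection X z

    prefix-> : rootReflection X y ≈ᵂ rootReflection X z →
      ∀ {p} → toℕ z < p → p ≤ m → P Y p ≈ᵂ P X p
    prefix-> tʸ≈tᶻ {p} z<p p≤m = agreeBetween⇒≈ (≤⇒≤′ z<p) p≤m (afterᶻ p)
      (W.trans prefix-after (W.trans
        (W.∙-congʳ (W.trans (W.∙-congʳ tʸ≈tᶻ) (reflection-involutive _ _))) (W.identityˡ _)))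

    rootReflection-≈ : P Y m ≈ᵂ P X m → rootReflection X y ≈ᵂ rootReflection X z
    rootReflection-≈ eq = begin
      rootReflection X y     ≈⟨ W.inverseˡ-unique _ _ (W.identityˡ-unique _ _ (W.trans (W.sym prefix-after)
                                  (translate⁻¹ (≤⇒≤′ (toℕ<n z)) ℕ.≤-refl (afterᶻ m) eq))) ⟩
      rootReflection X z ⁻¹  ≈⟨ W.inverseˡ-unique _ _ (reflection-involutive _ _) ⟨
      rootReflection X z     ∎
      where open SetoidReasoning W.setoid

  ⁻¹-generator : ∀ s → generator s ⁻¹ ≈ᵂ generator s
  ⁻¹-generator s = W.sym (W.inverseˡ-unique _ _ (generator-involutive s))

  prefix-suc-inside : ∀ X k x → lookup X k ≡ inside →
    P X (suc (toℕ k)) ⁻¹ • x ≈ᴹ P X (toℕ k) ⁻¹ • x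
  prefix-suc-inside X k x eq = •-congʳ (W.⁻¹-cong (W.trans (prefix-suc Q X k)
    (W.trans (W.∙-congˡ (W.reflexive (≡.cong (λ b → letter b _) eq))) (W.identityʳ _))))

  prefix-suc-outside : ∀ X k x → lookup X k ≡ outside →
    P X (suc (toℕ k)) ⁻¹ • x ≈ᴹ generator (lookup Q k) • P X (toℕ k) ⁻¹ • x
  prefix-suc-outside X k x eq = ≈ᴹ-trans (•-congʳ (begin
    P X (suc (toℕ k)) ⁻¹                       ≈⟨ W.⁻¹-cong (W.trans (prefix-suc Q X k)
      (W.∙-congˡ (W.reflexive (≡.cong (λ b → letter b _) eq)))) ⟩
    (P X (toℕ k) ∙ generator (lookup Q k)) ⁻¹   ≈⟨ W.⁻¹-anti-homo-∙ _ _ ⟩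
    generator (lookup Q k) ⁻¹ ∙ P X (toℕ k) ⁻¹  ≈⟨ W.∙-congʳ (⁻¹-generator _) ⟩
    generator (lookup Q k) ∙ P X (toℕ k) ⁻¹     ∎)) (•-assoc _ _ x)
    where open SetoidReasoning W.setoid

  -- A discrete intermediate value argument, stepping back from `p′` until the sign is positive.
  crossing : ∀ X {x p p′} → Φ x → p ≤′ p′ → p′ ≤ m →
    Positive (P X p ⁻¹ • x) → Positive (-ᴹ (P X p′ ⁻¹ • x)) →
    ∃ λ k → p ≤ toℕ k × toℕ k < p′ × lookup X k ≡ outside × x ≈ᴹ root X k
  crossing X Φx ≤′-refl _ x>0 -x>0 =
    contradiction -x>0 (¬positive×negative (Φ-• _ Φx) x>0)
  crossing X {x} {p} Φx (≤′-step {p′} p≤p′) p′<m x>0 -x>0 with at p′<m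
  ... | k , ≡.refl with sign (Φ-• (P X (toℕ k) ⁻¹) Φx) | lookup X k in Xₖ
  ... | inj₂ -xₖ>0 | _ =
    let k′ , p≤k′ , k′<k , rest = crossing X Φx p≤p′ (ℕ.<⇒≤ p′<m) x>0 -xₖ>0
    in k′ , p≤k′ , ℕ.m≤n⇒m≤1+n k′<k , rest
  ... | inj₁ xₖ>0 | inside = contradiction
    (Positive-resp (-ᴹ‿cong (prefix-suc-inside X k x Xₖ)) -x>0)
    (¬positive×negative (Φ-• _ Φx) xₖ>0)
  -- The generator of `k` makes a positive root negative, so this is the simple root of `k`, and the
  -- prefix carries it to `root X k`.
  ... | inj₁ xₖ>0 | outside = k , ≤′⇒≤ p≤p′ , ℕ.≤-refl , Xₖ ,
    ≈ᴹ-trans (≈ᴹ-sym (•-inverseʳ _ x)) (•-congˡ (only-α-made-negative (lookup Q k) (Φ-• _ Φx) xₖ>0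
      (Positive-resp (-ᴹ‿cong (prefix-suc-outside X k x Xₖ)) -x>0)))

-- Facets and the exchange property

module Facets {K : OrderedField c ℓ₁ ℓ₂ ℓ₃} {V : EuclideanSpace K v ℓv}
              {C : FiniteCoxeterSystem w ℓw} (R : ReflectionAction V C)
              {m : ℕ} (Q : Vec (FiniteCoxeterSystem.S C) m) (ρ : FiniteCoxeterSystem.Carrier C) where
  open EuclideanSpace V
  open FiniteCoxeterSystem C using (_∙_; _⁻¹; ε) renaming (Carrier to W; _≈_ to _≈ᵂ_)
  open ReflectionAction R
  open RootSystem R
  open Prefixes R
  open Positions R Q
  open SubwordComplex R Q ρ
  private
    module W where
      open FiniteCoxeterSystem C public
      open GroupProperties group public
    open ModuleProperties vectorSpace using (-ᴹ-involutive)
    t = rootReflection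
    r = root

  P-all : ∀ {X} → Facet X → P X m ≈ᵂ ρ
  P-all {X} (product≈ρ , _) = W.trans (prefix-all Q X) product≈ρ

  facet⁺ : ∀ {X Y} → Facet X → P Y m ≈ᵂ P X m → ∣ ∁ Y ∣ ≤ ∣ ∁ X ∣ → Facet Y
  facet⁺ {X} {Y} X-facet eq card =
    W.trans (W.sym (prefix-all Q Y)) (W.trans eq (P-all X-facet)) ,
    λ u u≈ρ → ℕ.≤-trans (≡.subst₂ _≤_ (≡.sym (length-subword Q (∁ Y))) (≡.sym (length-subword Q (∁ X))) card)
                         (proj₂ X-facet u u≈ρ)

  facet-minimal : ∀ {X Y} → Facet X → P Y m ≈ᵂ P X m → ∣ ∁ X ∣ ≤ ∣ ∁ Y ∣
  facet-minimal {X} {Y} X-facet eq = ≡.subst₂ _≤_ (length-subword Q (∁ X)) (length-subword Q (∁ Y))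
    (proj₂ X-facet (subword Q (∁ Y)) (W.trans (W.sym (prefix-all Q Y)) (W.trans eq (P-all X-facet))))

  lookup-∁⁺ : ∀ {X : Subset m} {k} → lookup X k ≡ outside → k ∈ ∁ X
  lookup-∁⁺ {X} {k} eq = lookup⇒[]= k (∁ X) (≡.trans (lookup-∁ X k) (≡.cong not eq))

  lookup-∁⁻ : ∀ {X : Subset m} {k} → k ∈ ∁ X → lookup X k ≡ outside
  lookup-∁⁻ {X} {k} k∈ = ≡.trans (≡.sym (not-involutive _))
    (≡.cong not (≡.trans (≡.sym (lookup-∁ X k)) ([]=⇒lookup k∈)))

  -- Two equal reflections could both be omitted, making the expression shorter.
  distinct-reflections-< : ∀ {X y z} → Facet X → lookup X y ≡ outside → lookup X z ≡ outside →
    toℕ y < toℕ z → ¬ t X y ≈ᵂ t X z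
  distinct-reflections-< {X} {y} {z} X-facet y∉X z∉X y<z tʸ≈tᶻ =
    ℕ.<⇒≱ (p⊂q⇒∣p∣<∣q∣ ∁Y⊂∁X) (facet-minimal X-facet (prefix-> toggled tʸ≈tᶻ (toℕ<n z) ℕ.≤-refl))
    where
    Y = update₂ X y inside z inside
    y≢z : y ≢ z
    y≢z ≡.refl = ℕ.<-irrefl ≡.refl y<z
    Y-y : lookup Y y ≡ inside
    Y-y = lookup-update₂-fst X y≢z
    toggled : Toggled X Y y z
    toggled = record
      { y<z       = y<z
      ; lookup-y  = ≡.trans Y-y (≡.cong not (≡.sym y∉X))
      ; lookup-z  = ≡.trans (lookup-update₂-snd X {y}) (≡.cong not (≡.sym z∉X))
      ; elsewhere = lookup-update₂-else X
      }
    ∁Y⊂∁X : ∁ Y ⊂ ∁ X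
    ∁Y⊂∁X = sub , y , lookup-∁⁺ y∉X , λ y∈∁Y → inside≢outside {X = Y} Y-y (lookup-∁⁻ {Y} y∈∁Y)
      where
      sub : ∁ Y ⊆ ∁ X
      sub {k} k∈∁Y with k ≟ y | k ≟ z
      ... | yes ≡.refl | _          = lookup-∁⁺ y∉X
      ... | no  _      | yes ≡.refl = lookup-∁⁺ z∉X
      ... | no  k≢y    | no k≢z     = lookup-∁⁺ (≡.trans (≡.sym (Toggled.elsewhere toggled k k≢y k≢z)) (lookup-∁⁻ {Y} k∈∁Y))

  distinct-reflections : ∀ {X y z} → Facet X → lookup X y ≡ outside → lookup X z ≡ outside →
    t X y ≈ᵂ t X z → y ≡ z
  distinct-reflections {y = y} {z} X-facet y∉X z∉X tʸ≈tᶻ with ℕ.<-cmp (toℕ y) (toℕ z)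
  ... | tri< y<z _ _ = contradiction tʸ≈tᶻ (distinct-reflections-< X-facet y∉X z∉X y<z)
  ... | tri≈ _ y≡z _ = toℕ-injective y≡z
  ... | tri> _ _ z<y = contradiction (W.sym tʸ≈tᶻ) (distinct-reflections-< X-facet z∉X y∉X z<y)

  equalUpToSign⇒≡ : ∀ {X y z} → Facet X → lookup X y ≡ outside → lookup X z ≡ outside →
    EqualUpToSign (r X y) (r X z) → y ≡ z
  equalUpToSign⇒≡ X-facet y∉X z∉X opp =
    distinct-reflections X-facet y∉X z∉X (equalUpToSign⇒reflection-≈ _ _ _ _ opp)

  root-at : ∀ X y → P X (toℕ y) ⁻¹ • r X y ≈ᴹ α (lookup Q y)
  root-at X y = •-inverseˡ _ _

  -ᴹ-swap : ∀ {x y} → -ᴹ x ≈ᴹ y → x ≈ᴹ -ᴹ y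
  -ᴹ-swap -x≈y = ≈ᴹ-trans (≈ᴹ-sym (-ᴹ-involutive _)) (-ᴹ‿cong -x≈y)

  -ᴹ-•-neg : ∀ g x → -ᴹ (g • (-ᴹ x)) ≈ᴹ g • x
  -ᴹ-•-neg g x = ≈ᴹ-trans (-ᴹ‿cong (•-neg g x)) (-ᴹ-involutive _)

  -- Were the sign wrong, it would change at a second letter with the same reflection.
  root-positive : ∀ {X y p} → Facet X → lookup X y ≡ outside → p ≤ toℕ y → Positive (P X p ⁻¹ • r X y)
  root-positive {X} {y} {p} X-facet y∉X p≤y with sign (Φ-• (P X p ⁻¹) (Φ-root X y))
  ... | inj₁ positive = positive
  ... | inj₂ negative =
    let k , _ , k<y , k∉X , -r≈ = crossing X (Φ-neg (Φ-root X y)) (≤⇒≤′ p≤y) (ℕ.<⇒≤ (toℕ<n y))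
          (Positive-resp (≈ᴹ-sym (•-neg _ _)) negative)
          (Positive-resp (≈ᴹ-sym (≈ᴹ-trans (-ᴹ-•-neg _ _) (root-at X y))) (α-positive _))
    in contradiction (≡.cong toℕ (equalUpToSign⇒≡ X-facet y∉X k∉X (inj₂ (-ᴹ-swap -r≈)))) (ℕ.>⇒≢ k<y)

  -- The generator at `y` itself makes the root negative, and a change back would give a second
  -- letter with the same reflection. With `root-positive`, the sign tells on which side of `p` the
  -- letter `y` lies.
  root-negative : ∀ {X y p} → Facet X → lookup X y ≡ outside → toℕ y < p → p ≤ m →
    Positive (-ᴹ (P X p ⁻¹ • r X y))
  root-negative {X} {y} {p} X-facet y∉X y<p p≤m with sign (Φ-• (P X p ⁻¹) (Φ-root X y))
  ... | inj₂ negative = negative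
  ... | inj₁ positive =
    let k , y<k , _ , k∉X , -r≈ = crossing X (Φ-neg (Φ-root X y)) (≤⇒≤′ y<p) p≤m
          (Positive-resp (≈ᴹ-sym after) (α-positive _))
          (Positive-resp (≈ᴹ-sym (-ᴹ-•-neg _ _)) positive)
    in contradiction (≡.cong toℕ (equalUpToSign⇒≡ X-facet y∉X k∉X (inj₂ (-ᴹ-swap -r≈)))) (ℕ.<⇒≢ y<k)
    where
    after : P X (suc (toℕ y)) ⁻¹ • (-ᴹ r X y) ≈ᴹ α (lookup Q y)
    after = ≈ᴹ-trans (•-neg _ _) (≈ᴹ-trans (-ᴹ‿cong (≈ᴹ-trans (prefix-suc-outside X y _ y∉X)
      (≈ᴹ-trans (•-congˡ (root-at X y)) (reflect-α _)))) (-ᴹ-involutive _))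

  flip⇒exchange : ∀ {X Y x y} → Flip X Y x y → Exchange Facet X Y x y
  flip⇒exchange {X} {Y} {x} {y} flip = record
    { facetˡ    = facetˡ
    ; facetʳ    = facetʳ
    ; x∈X       = []=⇒lookup i∈I
    ; x∉Y       = ≡.trans (≡.sym (lookup-kept Y y x x≢y)) (≡.trans (≡.cong (λ Z → lookup Z x) (≡.sym adjacent)) (lookup-removed X x))
    ; y∈Y       = []=⇒lookup j∈J
    ; y∉X       = ≡.trans (≡.sym (lookup-kept X x y (x≢y ∘ ≡.sym))) (≡.trans (≡.cong (λ Z → lookup Z y) adjacent) (lookup-removed Y y))
    ; elsewhere = same
    }
    where
    open Flip flip
    same : ∀ k → k ≢ x → k ≢ y → lookup Y k ≡ lookup X k
    same k k≢x k≢y = ≡.trans (≡.sym (lookup-kept Y y k k≢y))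
      (≡.trans (≡.cong (λ Z → lookup Z k) (≡.sym adjacent)) (lookup-kept X x k k≢x))
    x≢y : x ≢ y
    x≢y ≡.refl = distinct (lookup-injective λ k → case k ≟ x of λ where
      (yes ≡.refl) → ≡.trans ([]=⇒lookup i∈I) (≡.sym ([]=⇒lookup j∈J))
      (no k≢x)     → ≡.sym (same k k≢x k≢x))

  exchange⇒flip : ∀ {X Y x y} → Exchange Facet X Y x y → Flip X Y x y
  exchange⇒flip {X} {Y} {x} {y} exchange = record
    { facetˡ   = facetˡ
    ; facetʳ   = facetʳ
    ; distinct = λ { ≡.refl → inside≢outside {X = X} x∈X x∉Y }
    ; i∈I      = lookup⇒[]= x X x∈X
    ; j∈J      = lookup⇒[]= y Y y∈Y
    ; adjacent = lookup-injective same
    }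
    where
    open Exchange exchange
    same : ∀ k → lookup (X - x) k ≡ lookup (Y - y) k
    same k with k ≟ x | k ≟ y
    ... | yes ≡.refl | yes ≡.refl = contradiction x∉Y (inside≢outside {X = Y} y∈Y)
    ... | yes ≡.refl | no  k≢y    = ≡.trans (lookup-removed X k) (≡.trans (≡.sym x∉Y) (≡.sym (lookup-kept Y y k k≢y)))
    ... | no  k≢x    | yes ≡.refl = ≡.trans (lookup-kept X x k k≢x) (≡.trans y∉X (≡.sym (lookup-removed Y k)))
    ... | no  k≢x    | no  k≢y    = ≡.trans (lookup-kept X x k k≢x) (≡.trans (≡.sym (elsewhere k k≢x k≢y)) (≡.sym (lookup-kept Y y k k≢y)))

  toggle-up : ∀ {X Y x y} → Exchange Facet X Y x y → toℕ x < toℕ y → Toggled X Y x y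
  toggle-up exchange x<y = record
    { y<z = x<y ; lookup-y = ≡.trans x∉Y (≡.cong not (≡.sym x∈X))
    ; lookup-z = ≡.trans y∈Y (≡.cong not (≡.sym y∉X)) ; elsewhere = elsewhere }
    where open Exchange exchange

  toggle-down : ∀ {X Y x y} → Exchange Facet X Y x y → toℕ y < toℕ x → Toggled X Y y x
  toggle-down exchange y<x = record
    { y<z = y<x ; lookup-y = ≡.trans y∈Y (≡.cong not (≡.sym y∉X))
    ; lookup-z = ≡.trans x∉Y (≡.cong not (≡.sym x∈X)) ; elsewhere = λ k k≢y k≢x → elsewhere k k≢x k≢y }
    where open Exchange exchange

  exchange-≢ : ∀ {X Y x y} → Exchange Facet X Y x y → x ≢ y
  exchange-≢ {X} exchange ≡.refl = inside≢outside {X = X} x∈X y∉X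
    where open Exchange exchange

  exchange-reflection : ∀ {X Y x y} → Exchange Facet X Y x y → t X x ≈ᵂ t X y
  exchange-reflection {X} {Y} {x} {y} exchange with ℕ.<-cmp (toℕ x) (toℕ y)
  ... | tri< x<y _ _ = rootReflection-≈ (toggle-up exchange x<y) eq
    where
    open Exchange exchange
    eq = W.trans (P-all facetʳ) (W.sym (P-all facetˡ))
  ... | tri≈ _ x≡y _ = contradiction (toℕ-injective x≡y) (exchange-≢ exchange)
  ... | tri> _ _ y<x = W.sym (rootReflection-≈ (toggle-down exchange y<x) eq)
    where
    open Exchange exchange
    eq = W.trans (P-all facetʳ) (W.sym (P-all facetˡ))

  exchange-unique : ∀ {X Y Z x y z} → Exchange Facet X Y x y → Exchange Facet X Z x z → y ≡ z
  exchange-unique e f = distinct-reflections (Exchange.facetˡ e) (Exchange.y∉X e) (Exchange.y∉X f)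
    (W.trans (W.sym (exchange-reflection e)) (exchange-reflection f))

  exchange⁺ : ∀ {X x y} → Facet X → lookup X x ≡ inside → lookup X y ≡ outside →
    t X x ≈ᵂ t X y → ∃ λ Y → Exchange Facet X Y x y
  exchange⁺ {X} {x} {y} X-facet x∈X y∉X tˣ≈tʸ = Y , record
    { facetˡ = X-facet ; facetʳ = facet⁺ X-facet same-product card
    ; x∈X = x∈X ; x∉Y = Y-x ; y∈Y = Y-y ; y∉X = y∉X ; elsewhere = elsewhere }
    where
    Y = update₂ X x outside y inside
    x≢y : x ≢ y
    x≢y ≡.refl = inside≢outside {X = X} x∈X y∉X
    Y-x : lookup Y x ≡ outside
    Y-x = lookup-update₂-fst X x≢y
    Y-y : lookup Y y ≡ inside
    Y-y = lookup-update₂-snd X {x}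
    elsewhere : ∀ k → k ≢ x → k ≢ y → lookup Y k ≡ lookup X k
    elsewhere = lookup-update₂-else X
    same-product : P Y m ≈ᵂ P X m
    same-product with ℕ.<-cmp (toℕ x) (toℕ y)
    ... | tri< x<y _ _ = prefix-> (record
      { y<z = x<y ; lookup-y = ≡.trans Y-x (≡.cong not (≡.sym x∈X))
      ; lookup-z = ≡.trans Y-y (≡.cong not (≡.sym y∉X)) ; elsewhere = elsewhere })
      tˣ≈tʸ (toℕ<n y) ℕ.≤-refl
    ... | tri≈ _ x≡y _ = contradiction (toℕ-injective x≡y) x≢y
    ... | tri> _ _ y<x = prefix-> (record
      { y<z = y<x ; lookup-z = ≡.trans Y-x (≡.cong not (≡.sym x∈X))
      ; lookup-y = ≡.trans Y-y (≡.cong not (≡.sym y∉X)) ; elsewhere = λ k k≢y k≢x → elsewhere k k≢x k≢y })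
      (W.sym tˣ≈tʸ) (toℕ<n x) ℕ.≤-refl
    -- Auxiliary for the count: `∁ X` is `Z` with `y` added, and `∁ Y` is `Z` with `x` added.
    Z = ∁ X [ y ]≔ outside
    Z-kept : ∀ {k} → k ≢ x → k ∈ ∁ Y → k ∈ Z
    Z-kept {k} k≢x k∈∁Y with k ≟ y
    ... | yes ≡.refl = contradiction (lookup-∁⁻ {Y} k∈∁Y) (inside≢outside {X = Y} Y-y)
    ... | no  k≢y    = lookup⇒[]= k Z (≡.trans (lookup∘update′ k≢y (∁ X) outside)
      ([]=⇒lookup (lookup-∁⁺ {X} (≡.trans (≡.sym (elsewhere k k≢x k≢y)) (lookup-∁⁻ {Y} k∈∁Y)))))
    Z⊂∁X : Z ⊂ ∁ X
    Z⊂∁X = sub , y , lookup-∁⁺ y∉X , lookup≡outside⇒∉ (lookup∘update y (∁ X) outside)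
      where
      sub : Z ⊆ ∁ X
      sub {k} k∈Z with k ≟ y
      ... | yes ≡.refl = lookup-∁⁺ y∉X
      ... | no  k≢y    = lookup⇒[]= k (∁ X) (≡.trans (≡.sym (lookup∘update′ k≢y (∁ X) outside)) ([]=⇒lookup k∈Z))
    card : ∣ ∁ Y ∣ ≤ ∣ ∁ X ∣
    card = ℕ.≤-trans (∣p∣≤1+∣q∣ x Z-kept) (p⊂q⇒∣p∣<∣q∣ Z⊂∁X)

  -- `X` and `Y` have the same root at `y`. In `Y` it belongs to a letter, so `ρ ⁻¹` makes it
  -- negative; the prefix of `X` before `y` turns it into a simple root. `crossing` finds a letter
  -- of `X` where the sign changes.
  exchange-up : ∀ {X Y y} → Facet X → Facet Y → (∀ k → toℕ k < toℕ y → lookup X k ≡ lookup Y k) →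
    lookup X y ≡ inside → lookup Y y ≡ outside → ∃₂ λ Z k → Exchange Facet X Z y k × toℕ y < toℕ k
  exchange-up {X} {Y} {y} X-facet Y-facet agree y∈X y∉Y =
    let k , y≤k , _ , k∉X , r≈ = crossing X (Φ-root X y) (≤⇒≤′ (ℕ.<⇒≤ (toℕ<n y))) ℕ.≤-refl
          (Positive-resp (≈ᴹ-sym (root-at X y)) (α-positive _))
          (Positive-resp (-ᴹ‿cong (•-cong (W.⁻¹-cong (W.trans (P-all Y-facet) (W.sym (P-all X-facet)))) (•-congʳ same)))
            (root-negative Y-facet y∉Y (toℕ<n y) ℕ.≤-refl))
        Z , e = exchange⁺ X-facet y∈X k∉X (equalUpToSign⇒reflection-≈ _ _ _ _ (inj₁ r≈))
    in Z , k , e , ℕ.≤∧≢⇒< y≤k (exchange-≢ e ∘ toℕ-injective)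
    where
    same : P Y (toℕ y) ≈ᵂ P X (toℕ y)
    same = agreeBetween⇒≈ (≤⇒≤′ z≤n) (ℕ.<⇒≤ (toℕ<n y)) (λ k _ k<y → ≡.sym (agree k k<y)) W.refl

  -- Here the prefixes agree just behind `y`. Only `Y` uses the letter at `y`, so its root there is
  -- `-ᴹ r X y`. This vector is positive at the empty prefix, by `root-positive` for `Y`, and
  -- negative at the prefix of `X` before `y`.
  exchange-down : ∀ {X Y y} → Facet X → Facet Y → (∀ k → toℕ y < toℕ k → lookup X k ≡ lookup Y k) →
    lookup X y ≡ inside → lookup Y y ≡ outside → ∃₂ λ Z k → Exchange Facet X Z y k × toℕ k < toℕ y
  exchange-down {X} {Y} {y} X-facet Y-facet agree y∈X y∉Y =
    let k , _ , k<y , k∉X , -r≈ = crossing X (Φ-neg (Φ-root X y)) (≤⇒≤′ {0} z≤n) (ℕ.<⇒≤ (toℕ<n y))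
          (Positive-resp (•-congˡ rʸ≈) (root-positive Y-facet y∉Y z≤n))
          (Positive-resp (≈ᴹ-sym (≈ᴹ-trans (-ᴹ-•-neg _ _) (root-at X y))) (α-positive _))
        Z , e = exchange⁺ X-facet y∈X k∉X (equalUpToSign⇒reflection-≈ _ _ _ _ (inj₂ (-ᴹ-swap -r≈)))
    in Z , k , e , k<y
    where
    open SetoidReasoning ≈ᴹ-setoid
    same : P X (suc (toℕ y)) ≈ᵂ P Y (suc (toℕ y))
    same = translate⁻¹ (≤⇒≤′ (toℕ<n y)) ℕ.≤-refl (λ k y<k _ → agree k y<k)
      (W.trans (P-all X-facet) (W.sym (P-all Y-facet)))
    rʸ≈ : r Y y ≈ᴹ -ᴹ r X y
    rʸ≈ = -ᴹ-swap (begin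
      -ᴹ r Y y                                      ≈⟨ •-neg _ _ ⟨
      P Y (toℕ y) • (-ᴹ α (lookup Q y))             ≈⟨ •-congˡ (reflect-α _) ⟨
      P Y (toℕ y) • W.generator (lookup Q y) • α (lookup Q y) ≈⟨ •-assoc _ _ _ ⟨
      (P Y (toℕ y) ∙ W.generator (lookup Q y)) • α (lookup Q y) ≈⟨ •-congʳ (W.∙-congˡ (W.reflexive (≡.cong (λ b → letter b _) y∉Y))) ⟨
      (P Y (toℕ y) ∙ letter (lookup Y y) _) • α (lookup Q y) ≈⟨ •-congʳ (prefix-suc Q Y y) ⟨
      P Y (suc (toℕ y)) • α (lookup Q y)            ≈⟨ •-congʳ same ⟨
      P X (suc (toℕ y)) • α (lookup Q y)            ≈⟨ •-congʳ (prefix-suc Q X y) ⟩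
      (P X (toℕ y) ∙ letter (lookup X y) _) • α (lookup Q y) ≈⟨ •-congʳ (W.∙-congˡ (W.reflexive (≡.cong (λ b → letter b _) y∈X))) ⟩
      (P X (toℕ y) ∙ ε) • α (lookup Q y)            ≈⟨ •-congʳ (W.identityʳ _) ⟩
      r X y                                         ∎)

  root-translate : ∀ {X Y} g k → P Y (toℕ k) ≈ᵂ g ∙ P X (toℕ k) → r Y k ≈ᴹ g • r X k
  root-translate g k eq = ≈ᴹ-trans (•-congʳ eq) (•-assoc g _ _)

  root-reflect : ∀ {X Y} k → P Y (toℕ k) ≈ᵂ t X k ∙ P X (toℕ k) → r Y k ≈ᴹ -ᴹ r X k
  root-reflect k eq = ≈ᴹ-trans (root-translate _ k eq) (reflection-negates _ _)

  private
    -- The sign of `P X p ⁻¹ • r X k` is decided by the order of `k` and `p`, hence is the same for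
    -- `X` and `Y`; the two equations would make the signs opposite.
    signs-clash : ∀ {X Y k p} g → Facet X → Facet Y → lookup X k ≡ outside → lookup Y k ≡ outside →
      p ≤ m → P Y p ≈ᵂ g ∙ P X p → ¬ r Y k ≈ᴹ -ᴹ (g • r X k)
    signs-clash {X} {Y} {k} {p} g X-facet Y-facet k∉X k∉Y p≤m P≈ r≈ = case ℕ.≤-<-connex p (toℕ k) of λ where
        (inj₁ p≤k) → ¬positive×negative (Φ-• _ (Φ-root X k)) (root-positive X-facet k∉X p≤k)
          (Positive-resp relative (root-positive Y-facet k∉Y p≤k))
        (inj₂ k<p) → ¬positive×negative (Φ-• _ (Φ-root X k))
          (Positive-resp (≈ᴹ-trans (-ᴹ‿cong relative) (-ᴹ-involutive _)) (root-negative Y-facet k∉Y k<p p≤m))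
          (root-negative X-facet k∉X k<p p≤m)
      where
      open SetoidReasoning ≈ᴹ-setoid
      relative : P Y p ⁻¹ • r Y k ≈ᴹ -ᴹ (P X p ⁻¹ • r X k)
      relative = begin
        P Y p ⁻¹ • r Y k                      ≈⟨ •-cong (W.⁻¹-cong P≈) r≈ ⟩
        (g ∙ P X p) ⁻¹ • (-ᴹ (g • r X k))     ≈⟨ •-congʳ (W.⁻¹-anti-homo-∙ _ _) ⟩
        (P X p ⁻¹ ∙ g ⁻¹) • (-ᴹ (g • r X k))  ≈⟨ •-assoc _ _ _ ⟩
        P X p ⁻¹ • g ⁻¹ • (-ᴹ (g • r X k))    ≈⟨ •-congˡ (•-neg _ _) ⟩
        P X p ⁻¹ • (-ᴹ (g ⁻¹ • g • r X k))    ≈⟨ •-congˡ (-ᴹ‿cong (•-inverseˡ g _)) ⟩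
        P X p ⁻¹ • (-ᴹ r X k)                 ≈⟨ •-neg _ _ ⟩
        -ᴹ (P X p ⁻¹ • r X k)                 ∎

    εˡ : ∀ {g h} → g ≈ᵂ h → g ≈ᵂ ε ∙ h
    εˡ eq = W.trans eq (W.sym (W.identityˡ _))

  -- The flip of `i` negates the root at `j`, and `j` is a letter of both `A` and `Z`. The cut `p`
  -- is placed so that the flip of `x` multiplies the prefixes at `p` and at `j` by the same factor:
  -- just before `x` if `k` precedes `j`, just after `x` otherwise.
  no-return-up : ∀ {A B B₁ Z i j x k z} →
    Exchange Facet A B i j → toℕ i < toℕ j → Exchange Facet B B₁ x k → toℕ x < toℕ k → toℕ x < toℕ i →
    Exchange Facet B₁ Z j z → ¬ toℕ j < toℕ z
  no-return-up {A} {B} {B₁} {Z} {i} {j} {x} {k} AB i<j BB₁ x<k x<i B₁Z j<z = case ℕ.<-cmp (toℕ j) (toℕ k) of λ where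
      (tri> _ _ k<j) → signs-clash {p = toℕ x} ε A-facet Z-facet j∉A j∉Z (ℕ.<⇒≤ (toℕ<n x))
        (εˡ (W.trans (prefix-≤ BZ (ℕ.<⇒≤ (ℕ.<-trans x<i i<j)))
          (W.trans (prefix-≤ BB (ℕ.≤-refl)) (prefix-≤ AA (ℕ.<⇒≤ x<i)))))
        (≈ᴹ-trans (•-congʳ (W.trans (prefix-≤ BZ ℕ.≤-refl) (prefix-> BB (exchange-reflection BB₁) k<j (ℕ.<⇒≤ (toℕ<n j)))))
          (≈ᴹ-trans rᴮ (-ᴹ‿cong (≈ᴹ-sym (•-identity _)))))
      (tri≈ _ j≡k _) → contradiction (Exchange.y∈Y AB)
        (λ j∈B → inside≢outside {X = B} j∈B (≡.trans (≡.cong (lookup B) (toℕ-injective j≡k)) (Exchange.y∉X BB₁)))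
      (tri< j<k _ _) → signs-clash {p = suc (toℕ x)} (t B x) A-facet Z-facet j∉A j∉Z (toℕ<n x)
        (W.trans (prefix-≤ BZ (ℕ.<-trans x<i i<j)) (W.trans (prefix-between BB ℕ.≤-refl x<k)
          (W.∙-congˡ (prefix-≤ AA x<i))))
        (≈ᴹ-trans (≈ᴹ-trans (•-congʳ (prefix-≤ BZ ℕ.≤-refl))
          (root-translate (t B x) j (prefix-between BB (ℕ.<-trans x<i i<j) (ℕ.<⇒≤ j<k))))
          (≈ᴹ-trans (•-congˡ rᴮ) (•-neg _ _)))
    where
    A-facet = Exchange.facetˡ AB
    Z-facet = Exchange.facetʳ B₁Z
    j∉A = Exchange.y∉X AB
    j∉Z = Exchange.x∉Y B₁Z
    AA = toggle-up AB i<j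
    BB = toggle-up BB₁ x<k
    BZ = toggle-up B₁Z j<z
    rᴮ : r B j ≈ᴹ -ᴹ r A j
    rᴮ = root-reflect j (W.trans (prefix-between AA i<j ℕ.≤-refl) (W.∙-congʳ (exchange-reflection AB)))

  -- In the mirror image it is the flip of `j` to `z` that negates the root at `j`. The cut lies
  -- just after `x` if `j` precedes `k`, just before `x` otherwise.
  no-return-down : ∀ {A B B₁ Z i j x k z} →
    Exchange Facet A B i j → toℕ j < toℕ i → Exchange Facet B B₁ x k → toℕ k < toℕ x → toℕ i < toℕ x →
    Exchange Facet B₁ Z j z → ¬ toℕ z < toℕ j
  no-return-down {A} {B} {B₁} {Z} {i} {j} {x} {k} {z} AB j<i BB₁ k<x i<x B₁Z z<j = case ℕ.<-cmp (toℕ j) (toℕ k) of λ where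
      (tri< j<k _ _) → signs-clash {p = suc (toℕ x)} ε A-facet Z-facet j∉A j∉Z (toℕ<n x)
        (εˡ (W.trans (prefix-> BZ tᶻ (ℕ.m≤n⇒m≤1+n j<x) (toℕ<n x))
          (W.trans (prefix-> BB tᵏ ℕ.≤-refl (toℕ<n x))
            (prefix-> AA tʲ (ℕ.m≤n⇒m≤1+n i<x) (toℕ<n x)))))
        (≈ᴹ-trans rᶻ (-ᴹ‿cong (≈ᴹ-trans (•-congʳ (W.trans (prefix-≤ BB (ℕ.<⇒≤ j<k)) (prefix-≤ AA ℕ.≤-refl)))
          (≈ᴹ-sym (•-identity _)))))
      (tri≈ _ j≡k _) → contradiction (Exchange.y∈Y AB)
        (λ j∈B → inside≢outside {X = B} j∈B (≡.trans (≡.cong (lookup B) (toℕ-injective j≡k)) (Exchange.y∉X BB₁)))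
      (tri> _ _ k<j) → signs-clash {p = toℕ x} (t B k) A-facet Z-facet j∉A j∉Z (ℕ.<⇒≤ (toℕ<n x))
        (W.trans (prefix-> BZ tᶻ j<x (ℕ.<⇒≤ (toℕ<n x))) (W.trans (prefix-between BB k<x ℕ.≤-refl)
          (W.∙-congˡ (prefix-> AA tʲ i<x (ℕ.<⇒≤ (toℕ<n x))))))
        (≈ᴹ-trans rᶻ (-ᴹ‿cong (root-translate (t B k) j
          (W.trans (prefix-between BB k<j (ℕ.<⇒≤ j<x)) (W.∙-congˡ (prefix-≤ AA ℕ.≤-refl))))))
    where
    A-facet = Exchange.facetˡ AB
    Z-facet = Exchange.facetʳ B₁Z
    j∉A = Exchange.y∉X AB
    j∉Z = Exchange.x∉Y B₁Z
    AA = toggle-down AB j<i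
    BB = toggle-down BB₁ k<x
    BZ = toggle-down B₁Z z<j
    tʲ = W.sym (exchange-reflection AB)
    tᵏ = W.sym (exchange-reflection BB₁)
    tᶻ = W.sym (exchange-reflection B₁Z)
    j<x : toℕ j < toℕ x
    j<x = ℕ.<-trans j<i i<x
    rᶻ : r Z j ≈ᴹ -ᴹ r B₁ j
    rᶻ = root-reflect j (W.trans (prefix-between BZ z<j ℕ.≤-refl) (W.∙-congʳ tᶻ))

  -- `x` is a letter of `Y` with the same root as in `X`, and roots of letters are positive at the
  -- empty prefix, whose inverse is the factor `ε ⁻¹`.
  root-exchange-up : ∀ {X Y x y} → Exchange Facet X Y x y → toℕ x < toℕ y → Positive (ε ⁻¹ • r X x)
  root-exchange-up e x<y = Positive-resp (•-congˡ (•-congʳ (prefix-≤ (toggle-up e x<y) ℕ.≤-refl)))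
    (root-positive (Exchange.facetʳ e) (Exchange.x∉Y e) z≤n)

  -- The root at the letter `x` of `Y` is the negative of the root in `X`, and roots of letters are
  -- negative at the full prefix `ρ`.
  root-exchange-down : ∀ {X Y x y} → Exchange Facet X Y x y → toℕ y < toℕ x → Positive (ρ ⁻¹ • r X x)
  root-exchange-down {X} {Y} {x} e y<x = Positive-resp
    (≈ᴹ-trans (-ᴹ‿cong (•-cong (W.⁻¹-cong (P-all (Exchange.facetʳ e)))
      (≈ᴹ-trans (root-translate _ x (prefix-between T y<x ℕ.≤-refl))
        (≈ᴹ-trans (•-congʳ (W.sym (exchange-reflection e))) (reflection-negates _ _)))))
      (-ᴹ-•-neg _ _))
    (root-negative (Exchange.facetʳ e) (Exchange.x∉Y e) (toℕ<n x) ℕ.≤-refl)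
    where T = toggle-down e y<x

  private
    flippable : ∀ {X Y x y} → Exchange Facet X Y x y → Flippable X x
    flippable e = _ , _ , exchange⇒flip e

    -- Both roots belong to the reflection of `z`, so they agree up to sign. The signs after `g`
    -- exclude opposite roots, and equal ones at distinct positions are a double root.
    double-root : DoubleRootFree → ∀ g {X Y Z x y z} → Exchange Facet X Y x z → Exchange Facet X Z y z →
      Positive (g • r X x) → Positive (g • r X y) → x ≡ y
    double-root free g {X} {x = x} {y} e f gx>0 gy>0 with x ≟ y
    ... | yes x≡y = x≡y
    ... | no  x≢y = contradiction
      (X , Exchange.facetˡ e , x , y , x≢y , flippable e , flippable f ,
        ≈ᴹ-trans (•-congʳ (W.sym (prefix-before Q X x))) (≈ᴹ-trans rˣ≈rʸ (•-congʳ (prefix-before Q X y))))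
      free
      where
      rˣ≈rʸ : r X x ≈ᴹ r X y
      rˣ≈rʸ with reflection-≈⇒equalUpToSign _ _ _ _ (W.trans (exchange-reflection e) (W.sym (exchange-reflection f)))
      ... | inj₁ eq = eq
      ... | inj₂ eq = contradiction gx>0 λ gx>0 → ¬positive×negative (Φ-• g (Φ-root X y)) gy>0
        (Positive-resp (≈ᴹ-trans (•-congˡ eq) (•-neg g _)) gx>0)

  same-target-up : DoubleRootFree → ∀ {X Y Z x y z} → Exchange Facet X Y x z → Exchange Facet X Z y z →
    toℕ x < toℕ z → toℕ y < toℕ z → x ≡ y
  same-target-up free e f x<z y<z =
    double-root free _ e f (root-exchange-up e x<z) (root-exchange-up f y<z)

  same-target-down : DoubleRootFree → ∀ {X Y Z x y z} → Exchange Facet X Y x z → Exchange Facet X Z y z →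
    toℕ z < toℕ x → toℕ z < toℕ y → x ≡ y
  same-target-down free e f z<x z<y =
    double-root free _ e f (root-exchange-down e z<x) (root-exchange-down f z<y)

-- Reversal of positions, and lengths of paths

opposite-mono-< : {i j : Fin n} → toℕ j < toℕ i → toℕ (opposite i) < toℕ (opposite j)
opposite-mono-< {i = i} {j} j<i rewrite opposite-prop i | opposite-prop j = ℕ.∸-monoʳ-< (s≤s j<i) (toℕ<n i)

opposite-cancel-< : {i j : Fin n} → toℕ (opposite i) < toℕ (opposite j) → toℕ j < toℕ i
opposite-cancel-< {i = i} {j} lt with ℕ.<-cmp (toℕ j) (toℕ i)
... | tri< j<i _ _ = j<i
... | tri≈ _ j≡i _ = contradiction lt (ℕ.<-irrefl (≡.cong (toℕ ∘ opposite) (≡.sym (toℕ-injective j≡i))))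
... | tri> _ _ i<j = contradiction lt (ℕ.<-asym (opposite-mono-< i<j))

∈─⁻ : ∀ (p q : Subset n) {k} → k ∈ p ─ q → lookup p k ≡ inside × lookup q k ≡ outside
∈─⁻ p q {k} k∈ with lookup q k in eq
... | inside  = contradiction (lookup-zipWith-inside _ (λ _ → ≡.refl) p q k eq)
                  (inside≢outside {X = p ─ q} ([]=⇒lookup k∈))
... | outside = ≡.trans (≡.sym (lookup-zipWith-outside _ (λ _ → ≡.refl) p q k eq)) ([]=⇒lookup k∈) , ≡.refl

∈─⁺ : ∀ (p q : Subset n) {k} → lookup p k ≡ inside → lookup q k ≡ outside → k ∈ p ─ q
∈─⁺ p q {k} k∈p k∉q = lookup⇒[]= k (p ─ q)
  (≡.trans (lookup-zipWith-outside _ (λ _ → ≡.refl) p q k k∉q) k∈p)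

∣p─p∣≤0 : ∀ (p : Subset n) → ∣ p ─ p ∣ ≤ 0
∣p─p∣≤0 {n} p = ℕ.≤-trans (p⊆q⇒∣p∣≤∣q∣ empty) (ℕ.≤-reflexive (∣⊥∣≡0 n))
  where
  empty : p ─ p ⊆ Subset.⊥
  empty k∈ = let k∈p , k∉p = ∈─⁻ p p k∈ in contradiction k∉p (inside≢outside {X = p} k∈p)

linked-∷ : ∀ {a ℓ} {A : Set a} {_~_ : A → A → Set ℓ} {x xs} → All (x ~_) xs → Linked _~_ xs → Linked _~_ (x ∷ xs)
linked-∷ {xs = []}     _          _      = [-]
linked-∷ {xs = _ ∷ _} (x~y ∷ _) linked = x~y ∷ linked

open import Relation.Binary.Construct.Closure.ReflexiveTransitive using (ε; _◅_)

module Paths {K : OrderedField c ℓ₁ ℓ₂ ℓ₃} {V : EuclideanSpace K v ℓv}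
             {C : FiniteCoxeterSystem w ℓw} (R : ReflectionAction V C)
             {m : ℕ} (Q : Vec (FiniteCoxeterSystem.S C) m) (ρ : FiniteCoxeterSystem.Carrier C)
             (doubleRootFree : SubwordComplex.DoubleRootFree R Q ρ) where
  open SubwordComplex R Q ρ
  open Facets R Q ρ

  pos : Labelling → Fin m → ℕ
  pos 𝗉 = toℕ
  pos 𝗇 = toℕ ∘ opposite

  flipOrder : ∀ l → IsFlipOrder Facet (pos l)
  flipOrder 𝗉 = record
    { pos-injective   = toℕ-injective
    ; pos<m           = toℕ<n
    ; exchange-unique = exchange-unique
    ; exchangeable    = exchange-up
    ; no-return       = no-return-up
    ; same-target     = same-target-up doubleRootFree
    }
  flipOrder 𝗇 = record
    { pos-injective   = λ {i} {j} eq → ≡.trans (≡.sym (opposite-involutive i))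
                          (≡.trans (≡.cong opposite (toℕ-injective eq)) (opposite-involutive j))
    ; pos<m           = toℕ<n ∘ opposite
    ; exchange-unique = exchange-unique
    ; exchangeable    = λ X-facet Y-facet agree y∈X y∉Y →
        let Z , k , e , k<y = exchange-down X-facet Y-facet (λ k y<k → agree k (opposite-mono-< y<k)) y∈X y∉Y
        in Z , k , e , opposite-mono-< k<y
    ; no-return       = λ AB i≺j BB₁ x≺k x≺i B₁Z j≺z →
        no-return-down AB (opposite-cancel-< i≺j) BB₁ (opposite-cancel-< x≺k) (opposite-cancel-< x≺i)
          B₁Z (opposite-cancel-< j≺z)
    ; same-target     = λ e f x≺z y≺z →
        same-target-down doubleRootFree e f (opposite-cancel-< x≺z) (opposite-cancel-< y≺z)
    }

  private
    module Up   = Walks (flipOrder 𝗉)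
    module Down = Walks (flipOrder 𝗇)
    variable
      I J L : Subset m

  edge⇒exchange : (e : I ⟶ J) → Exchange Facet I J (_⟶_.i e) (_⟶_.j e)
  edge⇒exchange e = flip⇒exchange (_⟶_.flip e)

  exchange⇒edge : ∀ {x y} → Exchange Facet I J x y → toℕ x < toℕ y → I ⟶ J
  exchange⇒edge e x<y = record { flip = exchange⇒flip e ; increasing = x<y }

  path⇒walk : (P : Path I J) → Up.Walk 0 I J (pathLength P)
  path⇒walk ε       = Up.[]
  path⇒walk (e ◅ P) = Up.step (edge⇒exchange e) (_⟶_.increasing e) z≤n (path⇒walk P)

  -- Reversal with an accumulator: `walk` is the part already reversed, and `L` is the start of the
  -- whole path.
  path⇒reverseWalk : ∀ {a} (P : Path I J) → Down.Walk 0 I L a → ∃ λ k → Down.Walk 0 J L k × pathLength P + a ≤ k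
  path⇒reverseWalk ε walk = _ , walk , ℕ.≤-refl
  path⇒reverseWalk (e ◅ P) walk =
    let k , walk′ , ≤k = path⇒reverseWalk P (Down.step (exchange-sym Facet (edge⇒exchange e))
          (opposite-mono-< (_⟶_.increasing e)) z≤n walk)
    in k , walk′ , ℕ.≤-trans (ℕ.≤-reflexive (≡.sym (ℕ.+-suc (pathLength P) _))) ≤k

  rise⇒path : ∀ {p n} → Up.Rise p I J n →
    ∃ λ (P : Path I J) → Rising 𝗉 P × All (λ x → p ≤ toℕ x) (labels 𝗉 P) × pathLength P ≡ n
  rise⇒path Up.[] = ε , [] , [] , ≡.refl
  rise⇒path (Up.step e i<j p≤i rise) =
    let P , rising , above , eq = rise⇒path rise
    in exchange⇒edge e i<j ◅ P , linked-∷ above rising ,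
       p≤i ∷ All.map (λ i<x → ℕ.≤-trans p≤i (ℕ.<⇒≤ i<x)) above , ≡.cong suc eq

  -- Each reversed flip is put in front of the accumulated path `P`. Later flips of the rise have
  -- larger `pos 𝗇`, hence smaller labels, so the path stays rising.
  reverseRise⇒path : ∀ {p n} → Down.Rise p J I n → (P : Path J L) → Rising 𝗇 P →
    All (λ x → toℕ (opposite x) < p) (labels 𝗇 P) →
    ∃ λ (P′ : Path I L) → Rising 𝗇 P′ × pathLength P′ ≡ n + pathLength P
  reverseRise⇒path Down.[] P rising _ = P , rising , ≡.refl
  reverseRise⇒path (Down.step {n = n} e i≺j p≤i rise) P rising below =
    let P′ , rising′ , eq = reverseRise⇒path rise
          (exchange⇒edge (exchange-sym Facet e) (opposite-cancel-< i≺j) ◅ P)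
          (linked-∷ (All.map (λ x<p → opposite-cancel-< (ℕ.<-≤-trans x<p p≤i)) below) rising)
          (ℕ.≤-refl ∷ All.map (λ x<p → ℕ.≤-trans x<p (ℕ.≤-trans p≤i (ℕ.n≤1+n _))) below)
    in P′ , rising′ , ≡.trans eq (ℕ.+-suc n _)

  path⇒rise : ∀ {p} (P : Path I J) → AllPairs _<ᶠ_ (labels 𝗉 P) → All (λ x → p ≤ toℕ x) (labels 𝗉 P) →
    ∃ λ (rise : Up.Rise p I J (pathLength P)) → Up.riseVertices rise ≡ vertices P
  path⇒rise ε _ _ = Up.[] , ≡.refl
  path⇒rise (e ◅ P) (i<labels ∷ pairs) (p≤i ∷ _) =
    let rise , eq = path⇒rise P pairs i<labels
    in Up.step (edge⇒exchange e) (_⟶_.increasing e) p≤i rise , ≡.cong (_ ∷_) eq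

  -- `t` lists the facets passed before `I`, latest first. The reversal shows up as `_ʳ++_`, which
  -- `reverse-injective` removes when two paths are compared.
  path⇒reverseRise : ∀ {p a t} (P : Path I J) → AllPairs _<ᶠ_ (labels 𝗇 P) →
    (rise : Down.Rise p I L a) → Down.riseVertices rise ≡ I ∷ t →
    All (λ x → toℕ (opposite x) < p) (labels 𝗇 P) →
    ∃₂ λ q k → ∃ λ (rise′ : Down.Rise q J L k) → Down.riseVertices rise′ ≡ vertices P ʳ++ t
  path⇒reverseRise ε _ rise eq _ = _ , _ , rise , eq
  path⇒reverseRise (e ◅ P) (j<labels ∷ pairs) rise eq (j<p ∷ _) =
    path⇒reverseRise P pairs
      (Down.step (exchange-sym Facet (edge⇒exchange e)) (opposite-mono-< (_⟶_.increasing e)) ℕ.≤-refl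
        (Down.rise-≤ j<p rise))
      (≡.cong (_ ∷_) (≡.trans (Down.rise-≤-vertices j<p rise) eq))
      (All.map opposite-mono-< j<labels)

  rising-unique : ∀ l (P P′ : Path I J) → Rising l P → Rising l P′ → vertices P′ ≡ vertices P
  rising-unique 𝗉 P P′ rising rising′ =
    let rise , eq = path⇒rise P (Linked⇒AllPairs <ᶠ-trans rising) (All.universal (λ _ → z≤n) _)
        rise′ , eq′ = path⇒rise P′ (Linked⇒AllPairs <ᶠ-trans rising′) (All.universal (λ _ → z≤n) _)
    in ≡.trans (≡.sym eq′) (≡.trans (Up.rise-unique rise′ rise) eq)
  rising-unique 𝗇 P P′ rising rising′ =
    let _ , _ , rise , eq = path⇒reverseRise P (Linked⇒AllPairs <ᶠ-trans rising) Down.[] ≡.refl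
                              (All.universal (toℕ<n ∘ opposite) _)
        _ , _ , rise′ , eq′ = path⇒reverseRise P′ (Linked⇒AllPairs <ᶠ-trans rising′) Down.[] ≡.refl
                              (All.universal (toℕ<n ∘ opposite) _)
    in reverse-injective (≡.trans (≡.sym eq′) (≡.trans (Down.rise-unique rise′ rise) eq))

  longer-rising : ∀ l (P : Path I J) → ∃ λ (P′ : Path I J) → Rising l P′ × pathLength P ≤ pathLength P′
  longer-rising 𝗉 P =
    let _ , rise , ≤n = Up.rise-longest m 0 (ℕ.+-identityʳ m) (path⇒walk P)
        P′ , rising , _ , eq = rise⇒path rise
    in P′ , rising , ℕ.≤-trans ≤n (ℕ.≤-reflexive (≡.sym eq))
  longer-rising 𝗇 P =
    let _ , walk , ≤k = path⇒reverseWalk P Down.[]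
        n , rise , ≤n = Down.rise-longest m 0 (ℕ.+-identityʳ m) walk
        P′ , rising , eq = reverseRise⇒path rise ε [] []
    in P′ , rising , ℕ.≤-trans (ℕ.≤-trans (ℕ.m≤m+n _ 0) (ℕ.≤-trans ≤k ≤n))
                       (ℕ.≤-trans (ℕ.m≤m+n n 0) (ℕ.≤-reflexive (≡.sym eq)))

  length-vertices : (P : Path I J) → length (vertices P) ≡ suc (pathLength P)
  length-vertices ε       = ≡.refl
  length-vertices (e ◅ P) = ≡.cong suc (length-vertices P)

  -- Some rising path is at least as long as `P′`; it has the vertices of `P`, and these determine
  -- the length.
  rising-maximal : ∀ l (P : Path I J) → Rising l P → MaximalLength P
  rising-maximal l P rising P′ =
    let P″ , rising″ , ≤P″ = longer-rising l P′
    in ℕ.≤-trans ≤P″ (ℕ.≤-reflexive (ℕ.suc-injective (≡.trans (≡.sym (length-vertices P″))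
         (≡.trans (≡.cong length (rising-unique l P P″ rising rising″)) (length-vertices P)))))

  -- A flip takes a single position out of the facet, so the difference to `J` loses at most one
  -- element.
  ∣I─J∣≤pathLength : (P : Path I J) → ∣ I ─ J ∣ ≤ pathLength P
  ∣I─J∣≤pathLength {I} ε = ∣p─p∣≤0 I
  ∣I─J∣≤pathLength {I} {J} (_◅_ {j = L} e P) = ℕ.≤-trans (∣p∣≤1+∣q∣ {p = I ─ J} {L ─ J} (_⟶_.i e) kept)
    (s≤s (∣I─J∣≤pathLength P))
    where
    module E = Exchange (edge⇒exchange e)
    kept : ∀ {k} → k ≢ _⟶_.i e → k ∈ I ─ J → k ∈ L ─ J
    kept {k} k≢i k∈ = let k∈I , k∉J = ∈─⁻ I J k∈ in
      ∈─⁺ L J (≡.trans (E.elsewhere k k≢i (Up.∈-≢ I k∈I E.y∉X)) k∈I) k∉J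

  -- The condition on a label under which its flip cannot take `y` out. For `𝗇` equality is
  -- harmless, since the position taken out is smaller than the label.
  NotBeyond : Labelling → Fin m → Fin m → Set
  NotBeyond 𝗉 y x = toℕ x < toℕ y
  NotBeyond 𝗇 y x = toℕ x ≤ toℕ y

  falling-keeps : ∀ l {y} (P : Path I J) → All (NotBeyond l y) (labels l P) →
    lookup I y ≡ inside → lookup J y ≡ inside
  falling-keeps l ε _ y∈I = y∈I
  falling-keeps {I} l {y} (e ◅ P) (bound ∷ bounds) y∈I = falling-keeps l P bounds
    (≡.trans (E.elsewhere y (λ { ≡.refl → ℕ.<-irrefl ≡.refl (below l bound) }) (Up.∈-≢ I y∈I E.y∉X)) y∈I)
    where
    module E = Exchange (edge⇒exchange e)
    below : ∀ l → NotBeyond l y (label l e) → toℕ (_⟶_.i e) < toℕ y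
    below 𝗉 i<y = i<y
    below 𝗇 j≤y = ℕ.<-≤-trans (_⟶_.increasing e) j≤y

  -- Along a falling path the positions that were flipped in are never flipped out, so
  -- by no-reentry each step removes a new element of I ─ J.
  falling-pathLength≤ : ∀ l (P : Path I J) → AllPairs _≥ᶠ_ (labels l P) → pathLength P ≤ ∣ I ─ J ∣
  falling-pathLength≤ l ε _ = z≤n
  falling-pathLength≤ {I} {J} l (_◅_ {j = L} e P) (e≥labels ∷ pairs) =
    ℕ.≤-<-trans (falling-pathLength≤ l P pairs) (p⊂q⇒∣p∣<∣q∣ L─J⊂I─J)
    where
    module E = Exchange (edge⇒exchange e)
    i = _⟶_.i e
    j = _⟶_.j e
    bound : ∀ l {x} → label l e ≥ᶠ x → NotBeyond l j x
    bound 𝗉 x≤i = ℕ.≤-<-trans x≤i (_⟶_.increasing e)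
    bound 𝗇 x≤j = x≤j
    i∉J : lookup J i ≡ outside
    -- The conclusion of `no-reentry` does not involve labels, so the order of `𝗉` serves both
    -- labellings.
    i∉J = Up.no-reentry (edge⇒exchange e) (_⟶_.increasing e) (path⇒walk P)
    j∈J : lookup J j ≡ inside
    j∈J = falling-keeps l P (All.map (bound l) e≥labels) E.y∈Y
    L─J⊂I─J : L ─ J ⊂ I ─ J
    L─J⊂I─J = sub , i , ∈─⁺ I J E.x∈X i∉J ,
      λ i∈ → inside≢outside {X = L} (proj₁ (∈─⁻ L J i∈)) E.x∉Y
      where
      sub : L ─ J ⊆ I ─ J
      sub {k} k∈ = let k∈L , k∉J = ∈─⁻ L J k∈ in
        ∈─⁺ I J (≡.trans (≡.sym (E.elsewhere k (Up.∈-≢ L k∈L E.x∉Y) (Up.∈-≢ J j∈J k∉J ∘ ≡.sym))) k∈L) k∉J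

  falling-minimal : ∀ l (P : Path I J) → Falling l P → MinimalLength P
  falling-minimal l P falling P′ =
    ℕ.≤-trans (falling-pathLength≤ l P (Linked⇒AllPairs (λ y≤x z≤y → ℕ.≤-trans z≤y y≤x) falling)) (∣I─J∣≤pathLength P′)

corollary5p5 : ∀ {c ℓ₁ ℓ₂ ℓ₃ v ℓv w ℓw : Level}
    (K : OrderedField c ℓ₁ ℓ₂ ℓ₃) (V : EuclideanSpace K v ℓv)
    (C : FiniteCoxeterSystem w ℓw) (R : ReflectionAction V C)
    {m : ℕ} (Q : Vec (FiniteCoxeterSystem.S C) m) (ρ : FiniteCoxeterSystem.Carrier C) →
    let open SubwordComplex R Q ρ in
    DoubleRootFree →
    (I J : Subset m) → Facet I → Facet J → Path I J →
    (l : Labelling) →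
    (∃ λ (P : Path I J) → IsUniqueRising l P × MaximalLength P) ×
    ((P : Path I J) → Falling l P → MinimalLength P)
corollary5p5 K V C R Q ρ doubleRootFree I J _ _ P l =
  let P′ , rising , _ = longer-rising l P
  in (P′ , (rising , λ P″ rising″ → rising-unique l P′ P″ rising rising″) , rising-maximal l P′ rising) ,
     falling-minimal l
  where open Paths R Q ρ doubleRootFree
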